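{- Let $T$ be a tree. Then $\rho_e^o(T)=\nu_I(T)$ if and only if $T\in\mathcal{F}\cup\{P_1,P_2\}$ (up to isomorphism).
   Context: All graphs are finite and simple. A matching $M$ of a graph $G$ is an induced matching if no two distinct edges of $M$ are joined by an edge of $G$; $\nu_I(G)$ denotes the maximum cardinality of an induced matching in $G$. A set $B\subseteq E(G)$ is an edge open packing set (EOP set) if for any two distinct edges $e_1,e_2\in B$ there is no edge $e\in E(G)\setminus\{e_1,e_2\}$ joining an endvertex of $e_1$ to an endvertex of $e_2$ (that is, no edge $e$ such that $e_1,e,e_2$ form a path with middle edge $e$ or a triangle). Edges of $B$ may share an endvertex. The maximum cardinality of an EOP set is the EOP number $\rho_e^o(G)$. $P_n$ is the path on $n$ vertices. For $k\ge 1$, the spider $S^k$ with $k$ legs is the tree obtained from the star $K_{1,k}$ with center $v$ by subdividing each edge exactly once; $v$ is called the center of $S^k$. (Equivalently, it is obtained from $k$ disjoint copies of $P_2$ by joining a new vertex $v$ to exactly one leaf of each copy.) For a tree $S$, $L(S)$ denotes its set of leaves. The family $\mathcal{F}$ consists of all trees $T=T(k_1,\ldots,k_n)$, $n\ge 1$, obtained from the disjoint union of $n$ spiders $S_1=S^{k_1},\ldots,S_n=S^{k_n}$, with $k_i\ge 2$ for each $i\in\{1,\ldots,n\}$ and with centers $v_1,\ldots,v_n$ respectively, by adding $n-1$ edges $e_1,\ldots,e_{n-1}$ (so that the result is a tree) such that: (C1) for every $i\in\{1,\ldots,n-1\}$, $e_i$ has an endvertex in $\{v_1,\ldots,v_n\}$;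 and (C2) for every $i\in\{1,\ldots,n\}$ there exist at least two vertices $x,y\in L(S_i)$ with $\deg_T(x)=\deg_T(y)=1$. -}

module Defs where

open import Data.Fin.Base using (Fin; toℕ)
open import Data.Fin.Properties using (all?; any?) renaming (_≟_ to _≟ᶠ_; _<?_ to _<ᶠ?_)
import Data.Fin.Base as Fin
open import Data.Fin.Subset using (Subset; _∈_; ∣_∣; inside; outside)
open import Data.Fin.Subset.Properties using (_∈?_)
open import Data.List.Base using (List; []; _∷_; _++_; [_]; length; map; filter; lookup; allFin; cartesianProduct)
open import Data.List.Extrema.Nat using (max)
open import Data.List.Membership.Propositional using () renaming (_∈_ to _∈ˡ_)
open import Data.List.Relation.Unary.Linked using (Linked)
open import Data.List.Relation.Unary.Unique.Propositional using (Unique)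
open import Data.Nat.Base using (ℕ; zero; suc; _≤_)
open import Data.Nat.Properties using (1+n≢n) renaming (_≟_ to _≟ⁿ_)
open import Data.Product.Base using (Σ; ∃; ∃-syntax; _×_; _,_; proj₁; proj₂; swap)
open import Data.Product.Properties using (≡-dec)
open import Data.Sum.Base as Sum using (_⊎_; inj₁; inj₂)
open import Data.Vec.Base using ([]; _∷_)
open import Function.Bundles using (_⇔_; _↔_; Inverse)
open import Level using (0ℓ)
open import Relation.Binary.Construct.Closure.ReflexiveTransitive using (Star)
open import Relation.Binary.Construct.Closure.Symmetric using (SymClosure; fwd; bwd; symmetric)
open import Relation.Binary.Core using (Rel)
open import Relation.Binary.Definitions using (DecidableEquality; Symmetric)
import Relation.Binary.Definitions as B
open import Relation.Binary.PropositionalEquality.Core using (_≡_; _≢_; refl; sym; trans; cong)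
open import Relation.Nullary.Decidable using (Dec; yes; no; map′; _×-dec_; _⊎-dec_; _→-dec_; ¬?)
open import Relation.Nullary.Negation.Core using (¬_)
open import Relation.Unary using (Pred; Decidable)

------------------------------------------------------------------------
-- Simple graphs

record Graph (V : Set) : Set₁ where
  field
    Adj    : Rel V 0ℓ
    adj?   : B.Decidable Adj
    adjSym : Symmetric Adj
    irrefl : ∀ x → ¬ Adj x x

open Graph public

infix 4 _≅_

record _≅_ {V W : Set} (G : Graph V) (H : Graph W) : Set where
  field
    vertices : V ↔ W
    adj⇔     : ∀ x y → Adj G x y ⇔ Adj H (Inverse.to vertices x) (Inverse.to vertices y)

-- x has exactly d neighbours.
HasDegree : {V : Set} → Graph V → V → ℕ → Set
HasDegree G x d = ∃[ ys ] (Unique ys × (∀ y → y ∈ˡ ys ⇔ Adj G x y) × length ys ≡ d)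

IsLeaf : {V : Set} → Graph V → V → Set
IsLeaf G x = HasDegree G x 1

-- A cycle x, x₁, …, xₗ, x on l + 1 ≥ 3 distinct vertices.
IsCycle : {V : Set} → Graph V → V → List V → Set
IsCycle G x xs = 2 ≤ length xs × Unique (x ∷ xs) × Linked (Adj G) (x ∷ xs ++ [ x ])

record IsTree {V : Set} (G : Graph V) : Set where
  field
    nonempty  : V
    connected : ∀ x y → Star (Adj G) x y
    acyclic   : ∀ x xs → ¬ IsCycle G x xs

------------------------------------------------------------------------
-- Edges and edge sets of a graph on the vertex set Fin n.  An edge is an
-- index into the list of its edges uv (u < v), so that edge sets are the
-- subsets of the set of indices.

module _ {n : ℕ} (G : Graph (Fin n)) where

  isEdge? : Decidable {A = Fin n × Fin n} (λ uv → proj₁ uv Fin.< proj₂ uv × Adj G (proj₁ uv) (proj₂ uv))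
  isEdge? (u , v) = (u <ᶠ? v) ×-dec adj? G u v

  edges : List (Fin n × Fin n)
  edges = filter isEdge? (cartesianProduct (allFin n) (allFin n))

  Edge : Set
  Edge = Fin (length edges)

  EdgeSet : Set
  EdgeSet = Subset (length edges)

  end₁ end₂ : Edge → Fin n
  end₁ e = proj₁ (lookup edges e)
  end₂ e = proj₂ (lookup edges e)

  _IsEndOf_ : Fin n → Edge → Set
  x IsEndOf e = x ≡ end₁ e ⊎ x ≡ end₂ e

  -- g joins an endvertex of e to an endvertex of f.
  Joins : Edge → Edge → Edge → Set
  Joins g e f = (end₁ g IsEndOf e × end₂ g IsEndOf f)
              ⊎ (end₂ g IsEndOf e × end₁ g IsEndOf f)

  ShareEnd : Edge → Edge → Set
  ShareEnd e f = ∃[ x ] (x IsEndOf e × x IsEndOf f)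

  IsEOP : EdgeSet → Set
  IsEOP B = ∀ e → e ∈ B → ∀ f → f ∈ B → e ≢ f →
            ¬ (∃[ g ] (g ≢ e × g ≢ f × Joins g e f))

  IsMatching : EdgeSet → Set
  IsMatching M = ∀ e → e ∈ M → ∀ f → f ∈ M → e ≢ f → ¬ ShareEnd e f

  IsInducedMatching : EdgeSet → Set
  IsInducedMatching M = IsMatching M ×
    (∀ e → e ∈ M → ∀ f → f ∈ M → e ≢ f → ¬ (∃[ g ] Joins g e f))

  private
    isEndOf? : ∀ x e → Dec (x IsEndOf e)
    isEndOf? x e = (x ≟ᶠ end₁ e) ⊎-dec (x ≟ᶠ end₂ e)

    joins? : ∀ g e f → Dec (Joins g e f)
    joins? g e f = (isEndOf? (end₁ g) e ×-dec isEndOf? (end₂ g) f)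
             ⊎-dec (isEndOf? (end₂ g) e ×-dec isEndOf? (end₁ g) f)

    pairwise? : {R : Edge → Edge → Set} → (∀ e f → Dec (R e f)) → (B : EdgeSet) →
                Dec (∀ e → e ∈ B → ∀ f → f ∈ B → e ≢ f → R e f)
    pairwise? R? B = all? λ e → (e ∈? B) →-dec all? λ f → (f ∈? B) →-dec
                       (¬? (e ≟ᶠ f) →-dec R? e f)

  isEOP? : Decidable IsEOP
  isEOP? = pairwise? λ e f → ¬? (any? λ g → ¬? (g ≟ᶠ e) ×-dec ¬? (g ≟ᶠ f) ×-dec joins? g e f)

  isMatching? : Decidable IsMatching
  isMatching? = pairwise? λ e f → ¬? (any? λ x → isEndOf? x e ×-dec isEndOf? x f)

  isInducedMatching? : Decidable IsInducedMatching
  isInducedMatching? M = isMatching? M ×-dec pairwise? (λ e f → ¬? (any? λ g → joins? g e f)) M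

------------------------------------------------------------------------
-- Maximum cardinalities

subsets : ∀ m → List (Subset m)
subsets zero    = [] ∷ []
subsets (suc m) = map (inside ∷_) (subsets m) ++ map (outside ∷_) (subsets m)

-- The value 0 for an unsatisfiable P plays no role: the empty set satisfies both
-- predicates that this is applied to.
maxCard : ∀ {m} {P : Pred (Subset m) 0ℓ} → Decidable P → ℕ
maxCard {m} P? = max 0 (map ∣_∣ (filter P? (subsets m)))

ρₑᵒ : ∀ {n} → Graph (Fin n) → ℕ
ρₑᵒ G = maxCard (isEOP? G)

νᴵ : ∀ {n} → Graph (Fin n) → ℕ
νᴵ G = maxCard (isInducedMatching? G)

------------------------------------------------------------------------
-- Constructions of graphs

symGraph : {V : Set} {R : Rel V 0ℓ} → B.Decidable R → (∀ x → ¬ R x x) → Graph V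
symGraph {R = R} R? R-irrefl = record
  { Adj    = SymClosure R
  ; adj?   = λ x y → map′ Sum.[ fwd , bwd ] (λ { (fwd p) → inj₁ p ; (bwd p) → inj₂ p })
                          (R? x y ⊎-dec R? y x)
  ; adjSym = symmetric R
  ; irrefl = λ { x (fwd p) → R-irrefl x p ; x (bwd p) → R-irrefl x p }
  }

path : ∀ n → Graph (Fin n)
path n = symGraph {R = λ i j → suc (toℕ i) ≡ toℕ j}
                  (λ i j → suc (toℕ i) ≟ⁿ toℕ j) (λ i → 1+n≢n)

data PartAdj {I : Set} {W : I → Set} (G : ∀ i → Graph (W i)) : Rel (Σ I W) 0ℓ where
  inPart : ∀ {i x y} → Adj (G i) x y → PartAdj G (i , x) (i , y)

disjointUnion : ∀ {n} {W : Fin n → Set} → (∀ i → Graph (W i)) → Graph (Σ (Fin n) W)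
disjointUnion {n} {W} G = record
  { Adj    = PartAdj G
  ; adj?   = dec
  ; adjSym = λ { (inPart {i} p) → inPart (adjSym (G i) p) }
  ; irrefl = λ { (i , x) (inPart p) → irrefl (G i) x p }
  }
  where
  dec : B.Decidable (PartAdj G)
  dec (i , x) (j , y) with i ≟ᶠ j
  ... | no  i≢j  = no λ { (inPart _) → i≢j refl }
  ... | yes refl = map′ inPart (λ { (inPart p) → p }) (adj? (G i) x y)

-- A family of r edges to be added to G, pairwise distinct as unordered pairs.
record NewEdges {V : Set} (G : Graph V) (r : ℕ) : Set where
  field
    ends     : Fin r → V × V
    loopless : ∀ i → proj₁ (ends i) ≢ proj₂ (ends i)
    new      : ∀ i → ¬ Adj G (proj₁ (ends i)) (proj₂ (ends i))
    distinct : ∀ i j → i ≢ j → ends i ≢ ends j × ends i ≢ swap (ends j)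

addEdges : ∀ {V r} → DecidableEquality V → (G : Graph V) → NewEdges G r → Graph V
addEdges {V} _≟_ G E = record
  { Adj    = λ x y → Adj G x y ⊎ Adj Added x y
  ; adj?   = λ x y → adj? G x y ⊎-dec adj? Added x y
  ; adjSym = Sum.map (adjSym G) (adjSym Added)
  ; irrefl = λ x → Sum.[ irrefl G x , irrefl Added x ]
  }
  where
  open NewEdges E
  Added : Graph V
  Added = symGraph {R = λ x y → ∃[ i ] ends i ≡ (x , y)}
    (λ x y → any? λ i → ≡-dec _≟_ _≟_ (ends i) (x , y))
    (λ { x (i , eq) → loopless i (trans (cong proj₁ eq) (sym (cong proj₂ eq))) })

------------------------------------------------------------------------
-- Spiders

-- middle j is the vertex subdividing the edge of K₁,ₖ from the center to foot j.
data SpiderVertex (k : ℕ) : Set where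
  center      : SpiderVertex k
  middle foot : Fin k → SpiderVertex k

data SpiderEdge {k : ℕ} : Rel (SpiderVertex k) 0ℓ where
  center-middle : ∀ j → SpiderEdge center (middle j)
  middle-foot   : ∀ j → SpiderEdge (middle j) (foot j)

_≟ˢ_ : ∀ {k} → DecidableEquality (SpiderVertex k)
center   ≟ˢ center   = yes refl
center   ≟ˢ middle _ = no λ ()
center   ≟ˢ foot _   = no λ ()
middle _ ≟ˢ center   = no λ ()
middle i ≟ˢ middle j = map′ (cong middle) (λ { refl → refl }) (i ≟ᶠ j)
middle _ ≟ˢ foot _   = no λ ()
foot _   ≟ˢ center   = no λ ()
foot _   ≟ˢ middle _ = no λ ()
foot i   ≟ˢ foot j   = map′ (cong foot) (λ { refl → refl }) (i ≟ᶠ j)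

spiderEdge? : ∀ {k} → B.Decidable (SpiderEdge {k})
spiderEdge? center     center     = no λ ()
spiderEdge? center     (middle j) = yes (center-middle j)
spiderEdge? center     (foot _)   = no λ ()
spiderEdge? (middle _) center     = no λ ()
spiderEdge? (middle _) (middle _) = no λ ()
spiderEdge? (middle i) (foot j)   = map′ (λ { refl → middle-foot i }) (λ { (middle-foot _) → refl }) (i ≟ᶠ j)
spiderEdge? (foot _)   _          = no λ ()

spider : ∀ k → Graph (SpiderVertex k)
spider k = symGraph spiderEdge? λ { center () ; (middle _) () ; (foot _) () }

------------------------------------------------------------------------
-- The family 𝓕.  The number of spiders is n = r + 1 ≥ 1, and r = n - 1
-- edges are added.

module _ {r : ℕ} (k : Fin (suc r) → ℕ) where

  SpidersVertex : Set
  SpidersVertex = Σ (Fin (suc r)) (λ i → SpiderVertex (k i))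

  spiders : Graph SpidersVertex
  spiders = disjointUnion (λ i → spider (k i))

  joinSpiders : NewEdges spiders r → Graph SpidersVertex
  joinSpiders = addEdges (≡-dec _≟ᶠ_ _≟ˢ_) spiders

  IsCenter : SpidersVertex → Set
  IsCenter x = ∃[ i ] x ≡ (i , center)

record Construction : Set where
  field
    {r}    : ℕ
    k      : Fin (suc r) → ℕ
    2≤k    : ∀ i → 2 ≤ k i
    E      : NewEdges (spiders k) r

  open NewEdges E public

  T : Graph (SpidersVertex k)
  T = joinSpiders k E

  field
    isTree : IsTree T
    C1     : ∀ i → IsCenter k (proj₁ (ends i)) ⊎ IsCenter k (proj₂ (ends i))
    C2     : ∀ i → ∃[ x ] ∃[ y ] (x ≢ y
               × IsLeaf (spider (k i)) x × IsLeaf (spider (k i)) y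
               × HasDegree T (i , x) 1 × HasDegree T (i , y) 1)

infix 4 _∈𝓕

_∈𝓕 : {V : Set} → Graph V → Set
G ∈𝓕 = ∃[ C ] (G ≅ Construction.T C)

{-# OPTIONS --safe #-}
module Submission where

-- If T is in 𝓕, every edge of an EOP set B has an end that lies on no other
-- edge of B.  Charging the edge to the leg through this end or, if the end is a
-- center, to a pendant leg of that spider whose middle is not the other end, is
-- injective.  So B is no larger than the induced matching of all middle-foot
-- edges.
--
-- Conversely let M be a maximum induced matching that is also a maximum EOP
-- set.  The uncovered vertices are to be the centers and the edges of M the
-- legs, and the edges of M have to be distributed so that every center obtains
-- two legs with a pendant foot.  Root T at an uncovered vertex and distribute
-- greedily from the leaves upwards: a center that has fewer than two unclaimed
-- pendant legs below it is needy and claims the edge of M above it.  If the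
-- root were needy, then an exchange along the claimed edges would turn M into a
-- larger EOP set.  As every uncovered vertex can be chosen as the root, the
-- greedy distribution succeeds.

open import Defs
open import Data.Empty using (⊥; ⊥-elim)
open import Data.Fin.Base as Fin using (Fin; zero; suc; punchIn; punchOut)
open import Data.Fin.Properties as Finₚ
  using (all?; any?; injective⇒≤; suc-injective; punchIn-injective; punchInᵢ≢i; punchIn-punchOut)
  renaming (_≟_ to _≟ᶠ_)
open import Data.Fin.Subset using (Subset; _∈_; ∣_∣; inside; outside; _-_) renaming (⊥ to ∅)
open import Data.Fin.Subset.Properties using (_∈?_; ∉⊥; ∣⊥∣≡0; x∈p⇒∣p-x∣<∣p∣; x∈p∧x≢y⇒x∈p-y)
open import Data.List.Base using (List; []; _∷_; _++_; [_]; length; lookup; map; filter; allFin; cartesianProduct)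
import Data.List.Extrema.Nat as Extrema
open import Data.List.Membership.Propositional using () renaming (_∈_ to _∈ˡ_)
open import Data.List.Membership.Propositional.Properties
  using (∈-map⁺; ∈-map⁻; ∈-filter⁺; ∈-filter⁻; ∈-++⁺ˡ; ∈-++⁺ʳ; ∈-lookup; ∈-allFin; ∈-cartesianProduct⁺)
import Data.List.Properties as Listₚ
open import Data.List.Relation.Unary.All as All using (All; []; _∷_)
import Data.List.Relation.Unary.All.Properties as Allₚ
open import Data.List.Relation.Unary.AllPairs using ([]; _∷_)
open import Data.List.Relation.Unary.Any as Any using (here; there)
open import Data.List.Relation.Unary.Any.Properties using (lookup-index)
open import Data.List.Relation.Unary.Linked as Linked using (Linked; [-]; _∷_)
import Data.List.Relation.Unary.Linked.Properties as Linkedₚ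
open import Data.List.Relation.Unary.Unique.Propositional using (Unique)
import Data.List.Relation.Unary.Unique.Propositional.Properties as Uniqueₚ
open import Data.Nat.Base using (ℕ; zero; suc; _≤_; _<_; _+_; z≤n; s≤s)
import Data.Nat.Properties as ℕₚ
open import Data.Product.Base using (∃; ∃-syntax; _×_; _,_; proj₁; proj₂)
open import Data.Sum.Base as Sum using (_⊎_; inj₁; inj₂)
open import Data.Vec.Base as Vec using ([]; _∷_; here; there)
import Data.Vec.Properties as Vecₚ
open import Function.Base using (_∘_; id; case_of_)
open import Function.Bundles using (_⇔_; Inverse; Equivalence; mk⇔; mk↔ₛ′)
open import Level using (0ℓ)
open import Relation.Binary.Construct.Closure.ReflexiveTransitive as Star using (Star; ε; _◅_)
open import Relation.Binary.Construct.Closure.Symmetric using (fwd; bwd)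
open import Relation.Binary.Definitions using (tri<; tri≈; tri>)
open import Relation.Binary.PropositionalEquality
  using (_≡_; _≢_; refl; sym; trans; cong; cong₂; subst; subst₂; module ≡-Reasoning)
open import Relation.Nullary using (¬_; Dec; yes; no; does; contradiction)
open import Relation.Nullary.Decidable using (_×-dec_; _⊎-dec_; _→-dec_; ¬?; dec-true; map′)
open import Relation.Unary using (Pred; Decidable)

-- The exchange works with vertex sets `X` that induce a disjoint union of stars, because the edges
-- inside such a set form an EOP set. Suppose the root is needy. The edge from the root to one
-- covered child, its hub, is gained and forms a star with the matching edge of the hub. The root
-- can then keep no other covered child t in `X`. If the mate b of t has a child w, then b becomes a
-- leaf of a star at w; the tops below w become further leaves and trade their own edges for the
-- edges to w. If b has no child, then t is pendant, so by neediness some needy center below t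
-- claims it; the hub edge of that claimant makes up for the loss, and the argument continues there.
-- Every loss is made good, and the hub edge of the root is the surplus.
--
-- Neediness is defined for a branch, given by a vertex and an excluded neighbour, and not for a
-- rooting. Hence results from different roots can be combined: rooting at each uncovered u yields
-- two `Spare` neighbours of u, a statement free of roots, which is then used in the single rooting
-- that defines the distribution.

private variable
  m n : ℕ

-- Subsets of Fin n and edge sets

⟦_⟧ : {P : Pred (Fin n) 0ℓ} → Decidable P → Subset n
⟦ P? ⟧ = Vec.tabulate (does ∘ P?)

∈⟦⟧⁺ : {P : Pred (Fin n) 0ℓ} (P? : Decidable P) → ∀ {x} → P x → x ∈ ⟦ P? ⟧
∈⟦⟧⁺ P? {x} px = Vecₚ.lookup⇒[]= x _ (trans (Vecₚ.lookup∘tabulate (does ∘ P?) x) (dec-true (P? x) px))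

∈⟦⟧⁻ : {P : Pred (Fin n) 0ℓ} (P? : Decidable P) → ∀ {x} → x ∈ ⟦ P? ⟧ → P x
∈⟦⟧⁻ P? {x} x∈ with P? x | trans (sym (Vecₚ.lookup∘tabulate (does ∘ P?) x)) (Vecₚ.[]=⇒lookup x∈)
... | yes px | _ = px
... | no _   | ()

nth : (p : Subset n) → Fin ∣ p ∣ → Fin n
nth (inside  ∷ p) zero    = zero
nth (inside  ∷ p) (suc i) = suc (nth p i)
nth (outside ∷ p) i       = suc (nth p i)

nth-∈ : (p : Subset n) → ∀ i → nth p i ∈ p
nth-∈ (inside  ∷ p) zero    = here
nth-∈ (inside  ∷ p) (suc i) = there (nth-∈ p i)
nth-∈ (outside ∷ p) i       = there (nth-∈ p i)

nth-injective : (p : Subset n) → ∀ {i j} → nth p i ≡ nth p j → i ≡ j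
nth-injective (inside  ∷ p) {zero}  {zero}  _  = refl
nth-injective (inside  ∷ p) {suc _} {suc _} eq = cong suc (nth-injective p (suc-injective eq))
nth-injective (outside ∷ p) eq = nth-injective p (suc-injective eq)

nth-surjective : (p : Subset n) → ∀ {x} → x ∈ p → ∃[ i ] nth p i ≡ x
nth-surjective (inside  ∷ p) here      = zero , refl
nth-surjective (inside  ∷ p) (there x∈) with i , refl ← nth-surjective p x∈ = suc i , refl
nth-surjective (outside ∷ p) (there x∈) with i , refl ← nth-surjective p x∈ = i , refl

-- An injection given as a relation: the partner of an element may depend on the proof of
-- membership, since `inj` covers all possible partners.
∣∣-mono-rel : {p : Subset m} {q : Subset n} (R : Fin m → Fin n → Set) →
              (∀ {x} → x ∈ p → ∃[ y ] (y ∈ q × R x y)) →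
              (∀ {x x′ y} → x ∈ p → x′ ∈ p → R x y → R x′ y → x ≡ x′) → ∣ p ∣ ≤ ∣ q ∣
∣∣-mono-rel {p = p} {q} R total inj = injective⇒≤ {f = f} f-injective
  where
  image : ∀ i → ∃[ y ] (y ∈ q × R (nth p i) y)
  image i = total (nth-∈ p i)

  f : Fin ∣ p ∣ → Fin ∣ q ∣
  f i = proj₁ (nth-surjective q (proj₁ (proj₂ (image i))))

  nth-f : ∀ i → nth q (f i) ≡ proj₁ (image i)
  nth-f i = proj₂ (nth-surjective q (proj₁ (proj₂ (image i))))

  f-injective : ∀ {i j} → f i ≡ f j → i ≡ j
  f-injective {i} {j} eq = nth-injective p (inj (nth-∈ p i) (nth-∈ p j)
    (subst (R _) (trans (sym (nth-f i)) (cong (nth q) eq)) (proj₂ (proj₂ (image i))))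
    (subst (R _) (sym (nth-f j)) (proj₂ (proj₂ (image j)))))

∈-subsets : (p : Subset n) → p ∈ˡ subsets n
∈-subsets []            = here refl
∈-subsets (inside  ∷ p) = ∈-++⁺ˡ (∈-map⁺ (inside ∷_) (∈-subsets p))
∈-subsets {n = suc n} (outside ∷ p) =
  ∈-++⁺ʳ (map (inside ∷_) (subsets n)) (∈-map⁺ (outside ∷_) (∈-subsets p))

module _ {P : Pred (Subset n) 0ℓ} (P? : Decidable P) where

  ≤-maxCard : ∀ p → P p → ∣ p ∣ ≤ maxCard P?
  ≤-maxCard p Pp = All.lookup (Extrema.xs≤max 0 _) (∈-map⁺ ∣_∣ (∈-filter⁺ P? (∈-subsets p) Pp))

  maxCard-≤ : ∀ {k} → (∀ p → P p → ∣ p ∣ ≤ k) → maxCard P? ≤ k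
  maxCard-≤ bound = Extrema.max≤v⁺ z≤n (All.tabulate λ c∈ →
    let p , p∈ , eq = ∈-map⁻ ∣_∣ c∈
    in subst (_≤ _) (sym eq) (bound p (proj₂ (∈-filter⁻ P? {xs = subsets n} p∈))))

  maxCard-attained : P ∅ → ∃[ p ] (P p × ∣ p ∣ ≡ maxCard P?)
  maxCard-attained P⊥ with Extrema.argmax-sel id 0 (map ∣_∣ (filter P? (subsets n)))
  -- The maximum is the initial value `0` of the fold, and `∅` attains it.
  ... | inj₁ eq = ∅ , P⊥ , trans (∣⊥∣≡0 n) (sym eq)
  ... | inj₂ c∈ =
    let p , p∈ , eq = ∈-map⁻ ∣_∣ c∈
    in p , proj₂ (∈-filter⁻ P? {xs = subsets n} p∈) , sym eq

Unique⇒lookup-injective : {A : Set} {xs : List A} → Unique xs → ∀ {i j} → lookup xs i ≡ lookup xs j → i ≡ j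
Unique⇒lookup-injective (_ ∷ _)  {zero}  {zero}  _  = refl
Unique⇒lookup-injective (x∉ ∷ _) {zero}  {suc j} eq = contradiction eq (All.lookup x∉ (∈-lookup j))
Unique⇒lookup-injective (x∉ ∷ _) {suc i} {zero}  eq = contradiction (sym eq) (All.lookup x∉ (∈-lookup i))
Unique⇒lookup-injective (_ ∷ u)  {suc i} {suc j} eq = cong suc (Unique⇒lookup-injective u eq)

-- Edges and EOP sets in terms of endvertices

module Edges (G : Graph (Fin n)) where

  infix 4 _∼_ _IsEnd_

  _∼_ : Fin n → Fin n → Set
  _∼_ = Adj G

  _IsEnd_ : Fin n → Edge G → Set
  _IsEnd_ = _IsEndOf_ G

  isEnd? : ∀ x e → Dec (x IsEnd e)
  isEnd? x e = (x ≟ᶠ end₁ G e) ⊎-dec (x ≟ᶠ end₂ G e)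

  ∼-sym : ∀ {x y} → x ∼ y → y ∼ x
  ∼-sym = adjSym G

  ∼⇒≢ : ∀ {x y} → x ∼ y → x ≢ y
  ∼⇒≢ x∼y refl = irrefl G _ x∼y

  private
    lookup-edge : ∀ e → end₁ G e Fin.< end₂ G e × end₁ G e ∼ end₂ G e
    lookup-edge e = proj₂ (∈-filter⁻ (isEdge? G) {xs = cartesianProduct (allFin n) (allFin n)} (∈-lookup e))

    edges-unique : Unique (edges G)
    edges-unique = Uniqueₚ.filter⁺ (isEdge? G) (Uniqueₚ.cartesianProduct⁺ (Uniqueₚ.allFin⁺ n) (Uniqueₚ.allFin⁺ n))

    edge-at : ∀ {x y} → x Fin.< y → x ∼ y → ∃[ e ] (x ≡ end₁ G e × y ≡ end₂ G e)
    edge-at x<y x∼y = Any.index xy∈ , cong proj₁ (lookup-index xy∈) , cong proj₂ (lookup-index xy∈)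
      where xy∈ = ∈-filter⁺ (isEdge? G) (∈-cartesianProduct⁺ (∈-allFin _) (∈-allFin _)) (x<y , x∼y)

  ends-adjacent : ∀ e → end₁ G e ∼ end₂ G e
  ends-adjacent e = proj₂ (lookup-edge e)

  ends-adjacent′ : ∀ {x y} e → x IsEnd e → y IsEnd e → x ≢ y → x ∼ y
  ends-adjacent′ e (inj₁ refl) (inj₁ refl) x≢y = contradiction refl x≢y
  ends-adjacent′ e (inj₁ refl) (inj₂ refl) x≢y = ends-adjacent e
  ends-adjacent′ e (inj₂ refl) (inj₁ refl) x≢y = ∼-sym (ends-adjacent e)
  ends-adjacent′ e (inj₂ refl) (inj₂ refl) x≢y = contradiction refl x≢y

  edge-on : ∀ {x y} → x ∼ y → ∃[ e ] (x IsEnd e × y IsEnd e)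
  edge-on {x} {y} x∼y with Finₚ.<-cmp x y
  ... | tri< x<y _ _ = let e , p , q = edge-at x<y x∼y in e , inj₁ p , inj₂ q
  ... | tri≈ _ refl _ = contradiction refl (∼⇒≢ x∼y)
  ... | tri> _ _ y<x = let e , p , q = edge-at y<x (∼-sym x∼y) in e , inj₂ q , inj₁ p

  third-end : ∀ {x y z} e → x IsEnd e → y IsEnd e → x ≢ y → z IsEnd e → z ≡ x ⊎ z ≡ y
  third-end e (inj₁ refl) (inj₁ refl) x≢y _ = contradiction refl x≢y
  third-end e (inj₁ refl) (inj₂ refl) x≢y z∈e = z∈e
  third-end e (inj₂ refl) (inj₁ refl) x≢y z∈e = Sum.swap z∈e
  third-end e (inj₂ refl) (inj₂ refl) x≢y _ = contradiction refl x≢y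

  other-end : ∀ {x} e → x IsEnd e → ∃[ y ] (y IsEnd e × x ∼ y)
  other-end e (inj₁ refl) = _ , inj₂ refl , ends-adjacent e
  other-end e (inj₂ refl) = _ , inj₁ refl , ∼-sym (ends-adjacent e)

  -- The ends of an edge are stored in increasing order, so common ends cannot sit in opposite
  -- positions; and the list of edges has no repetitions.
  edge-unique : ∀ {x y} e f → x IsEnd e → y IsEnd e → x IsEnd f → y IsEnd f → x ≢ y → e ≡ f
  edge-unique {x} {y} e f x∈e y∈e x∈f y∈f x≢y =
    Unique⇒lookup-injective edges-unique 
      (let p , q = same x∈e y∈e x∈f y∈f in cong₂ _,_ p q)
    where
    swapped : ∀ {u v} → u ≡ end₁ G e → v ≡ end₂ G e → v ≡ end₁ G f → u ≡ end₂ G f →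
              end₁ G e ≡ end₁ G f × end₂ G e ≡ end₂ G f
    swapped refl refl p q = contradiction (proj₁ (lookup-edge f))
      (Finₚ.<-asym (subst₂ Fin._<_ q p (proj₁ (lookup-edge e))))

    same : x IsEnd e → y IsEnd e → x IsEnd f → y IsEnd f → end₁ G e ≡ end₁ G f × end₂ G e ≡ end₂ G f
    same (inj₁ p) (inj₁ q) _ _ = contradiction (trans p (sym q)) x≢y
    same (inj₂ p) (inj₂ q) _ _ = contradiction (trans p (sym q)) x≢y
    same (inj₁ _) (inj₂ _) (inj₁ p) (inj₁ q) = contradiction (trans p (sym q)) x≢y
    same (inj₁ _) (inj₂ _) (inj₂ p) (inj₂ q) = contradiction (trans p (sym q)) x≢y
    same (inj₂ _) (inj₁ _) (inj₁ p) (inj₁ q) = contradiction (trans p (sym q)) x≢y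
    same (inj₂ _) (inj₁ _) (inj₂ p) (inj₂ q) = contradiction (trans p (sym q)) x≢y
    same (inj₁ p) (inj₂ q) (inj₁ r) (inj₂ s) = trans (sym p) r , trans (sym q) s
    same (inj₂ p) (inj₁ q) (inj₂ r) (inj₁ s) = trans (sym q) s , trans (sym p) r
    same (inj₁ p) (inj₂ q) (inj₂ r) (inj₁ s) = swapped p q s r
    same (inj₂ p) (inj₁ q) (inj₁ r) (inj₂ s) = swapped q p r s

  joins⁺ : ∀ {x y} g e f → x IsEnd e → y IsEnd f → x IsEnd g → y IsEnd g → x ≢ y → Joins G g e f
  joins⁺ g e f x∈e y∈f (inj₁ refl) (inj₁ refl) x≢y = contradiction refl x≢y
  joins⁺ g e f x∈e y∈f (inj₁ refl) (inj₂ refl) x≢y = inj₁ (x∈e , y∈f)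
  joins⁺ g e f x∈e y∈f (inj₂ refl) (inj₁ refl) x≢y = inj₂ (x∈e , y∈f)
  joins⁺ g e f x∈e y∈f (inj₂ refl) (inj₂ refl) x≢y = contradiction refl x≢y

  joins⁻ : ∀ g e f → Joins G g e f →
           ∃[ x ] ∃[ y ] (x IsEnd e × y IsEnd f × x IsEnd g × y IsEnd g × x ∼ y)
  joins⁻ g e f (inj₁ (p , q)) = _ , _ , p , q , inj₁ refl , inj₂ refl , ends-adjacent g
  joins⁻ g e f (inj₂ (p , q)) = _ , _ , p , q , inj₂ refl , inj₁ refl , ∼-sym (ends-adjacent g)

  ∅-isInducedMatching : IsInducedMatching G ∅
  ∅-isInducedMatching = (λ e e∈ → contradiction e∈ ∉⊥) , (λ e e∈ → contradiction e∈ ∉⊥)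

  inducedMatching⇒EOP : ∀ {M} → IsInducedMatching G M → IsEOP G M
  inducedMatching⇒EOP (_ , ind) e e∈ f f∈ e≢f (g , _ , _ , j) = ind e e∈ f f∈ e≢f (g , j)

  νᴵ≤ρₑᵒ : νᴵ G ≤ ρₑᵒ G
  νᴵ≤ρₑᵒ = maxCard-≤ (isInducedMatching? G) λ M ind → ≤-maxCard (isEOP? G) M (inducedMatching⇒EOP ind)

  -- The edge `xy` joins `e` to `f`, so unless these coincide it has to be one of them.
  EOP-adjacent : ∀ {B} → IsEOP G B → ∀ {x y e f} → e ∈ B → f ∈ B → x IsEnd e → y IsEnd f → x ∼ y →
                 e ≡ f ⊎ y IsEnd e ⊎ x IsEnd f
  EOP-adjacent eop {x} {y} {e} {f} e∈ f∈ x∈e y∈f x∼y with e ≟ᶠ f | isEnd? y e | isEnd? x f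
  ... | yes e≡f | _ | _ = inj₁ e≡f
  ... | no _ | yes y∈e | _ = inj₂ (inj₁ y∈e)
  ... | no _ | no _ | yes x∈f = inj₂ (inj₂ x∈f)
  ... | no e≢f | no y∉e | no x∉f =
    let g , x∈g , y∈g = edge-on x∼y
    in ⊥-elim (eop e e∈ f f∈ e≢f
         (g , (λ { refl → y∉e y∈g }) , (λ { refl → x∉f x∈g }) , joins⁺ g e f x∈e y∈f x∈g y∈g (∼⇒≢ x∼y)))

-- Sufficiency

module _ {V W : Set} {G : Graph V} {H : Graph W} (G≅H : G ≅ H) where
  open _≅_ G≅H
  open Inverse vertices using (to; from; strictlyInverseˡ; strictlyInverseʳ)

  ≅-to-adj : ∀ {x y} → Adj G x y → Adj H (to x) (to y)
  ≅-to-adj = Equivalence.to (adj⇔ _ _)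

  ≅-to-adj⁻ : ∀ {x y} → Adj H (to x) (to y) → Adj G x y
  ≅-to-adj⁻ = Equivalence.from (adj⇔ _ _)

  ≅-from-adj : ∀ {p q} → Adj H p q → Adj G (from p) (from q)
  ≅-from-adj p∼q = ≅-to-adj⁻ (subst₂ (Adj H) (sym (strictlyInverseˡ _)) (sym (strictlyInverseˡ _)) p∼q)

  ≅-from-adj⁻ : ∀ {p q} → Adj G (from p) (from q) → Adj H p q
  ≅-from-adj⁻ x∼y = subst₂ (Adj H) (strictlyInverseˡ _) (strictlyInverseˡ _) (≅-to-adj x∼y)

  ≅-from-injective : ∀ {p q} → from p ≡ from q → p ≡ q
  ≅-from-injective eq = trans (sym (strictlyInverseˡ _)) (trans (cong to eq) (strictlyInverseˡ _))

  ≅-to-injective : ∀ {x y} → to x ≡ to y → x ≡ y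
  ≅-to-injective eq = trans (sym (strictlyInverseʳ _)) (trans (cong from eq) (strictlyInverseʳ _))

degree-1⇒≡ : {V : Set} (G : Graph V) → ∀ {x y z} → HasDegree G x 1 → Adj G x y → Adj G x z → y ≡ z
degree-1⇒≡ G (w ∷ [] , _ , nbr , refl) x∼y x∼z
  with Equivalence.from (nbr _) x∼y | Equivalence.from (nbr _) x∼z
... | here refl | here refl = refl

module _ (G : Graph (Fin n)) where
  open Edges G

  -- There is at most one edge, so every edge set is an induced matching.
  two-vertices⇒ρₑᵒ≡νᴵ : (∀ a b c → a ≢ b → c ≡ a ⊎ c ≡ b) → ρₑᵒ G ≡ νᴵ G
  two-vertices⇒ρₑᵒ≡νᴵ third = ℕₚ.≤-antisym
    (maxCard-≤ (isEOP? G) λ B _ → ≤-maxCard (isInducedMatching? G) B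
      ((λ e _ f _ e≢f → contradiction (all-equal e f) e≢f) , (λ e _ f _ e≢f → contradiction (all-equal e f) e≢f)))
    νᴵ≤ρₑᵒ
    where
    all-ends : ∀ x e → x IsEnd e
    all-ends x e = third (end₁ G e) (end₂ G e) x (∼⇒≢ (ends-adjacent e))

    all-equal : ∀ e f → e ≡ f
    all-equal e f = edge-unique e f (inj₁ refl) (inj₂ refl) (all-ends _ f) (all-ends _ f) (∼⇒≢ (ends-adjacent e))

  path-≅⇒ρₑᵒ≡νᴵ : G ≅ path 1 ⊎ G ≅ path 2 → ρₑᵒ G ≡ νᴵ G
  path-≅⇒ρₑᵒ≡νᴵ (inj₁ iso) = two-vertices⇒ρₑᵒ≡νᴵ λ a b _ a≢b → contradiction (≅-to-injective iso (Fin1 _ _)) a≢b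
    where
    Fin1 : (i j : Fin 1) → i ≡ j
    Fin1 zero zero = refl
  path-≅⇒ρₑᵒ≡νᴵ (inj₂ iso) = two-vertices⇒ρₑᵒ≡νᴵ λ a b c a≢b →
    Sum.map (≅-to-injective iso) (≅-to-injective iso) (Fin2 _ _ _ (a≢b ∘ ≅-to-injective iso))
    where
    Fin2 : (i j l : Fin 2) → i ≢ j → l ≡ i ⊎ l ≡ j
    Fin2 zero       zero       _          i≢j = contradiction refl i≢j
    Fin2 (suc zero) (suc zero) _          i≢j = contradiction refl i≢j
    Fin2 zero       (suc zero) zero       _   = inj₁ refl
    Fin2 zero       (suc zero) (suc zero) _   = inj₂ refl
    Fin2 (suc zero) zero       zero       _   = inj₂ refl
    Fin2 (suc zero) zero       (suc zero) _   = inj₁ refl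

  -- Trees of the family: an EOP set has at most one edge per leg

  module _ (C : Construction) (G≅T : G ≅ Construction.T C) where
    open Construction C
    open _≅_ G≅T
    open Inverse vertices using (to; from; strictlyInverseʳ)

    private
      mid ft : ∀ i → Fin (k i) → Fin n
      mid i j = from (i , middle j)
      ft  i j = from (i , foot j)

      ctr : Fin (suc r) → Fin n
      ctr i = from (i , center)

      ctr∼mid : ∀ i j → ctr i ∼ mid i j
      ctr∼mid i j = ≅-from-adj G≅T (inj₁ (inPart (fwd (center-middle j))))

      mid∼ft : ∀ i j → mid i j ∼ ft i j
      mid∼ft i j = ≅-from-adj G≅T (inj₁ (inPart (fwd (middle-foot j))))

      data InLeg (i : Fin (suc r)) (j : Fin (k i)) : SpidersVertex k → Set where
        inMiddle : InLeg i j (i , middle j)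
        inFoot   : InLeg i j (i , foot j)

      center∉leg : ∀ {i j x} → InLeg i j x → ¬ IsCenter k x
      center∉leg inMiddle (_ , ())
      center∉leg inFoot   (_ , ())

      added-edge-has-center : ∀ {x y i} → ends i ≡ (x , y) → IsCenter k x ⊎ IsCenter k y
      added-edge-has-center {i = i} refl = C1 i

      -- By C1 an added edge ends at a center and never joins two legs. This is what makes the
      -- middle-foot edges an induced matching.
      leg-adjacent : ∀ {i j i′ j′ x y} → InLeg i j x → InLeg i′ j′ y → Adj T x y → InLeg i j y
      leg-adjacent inMiddle inMiddle (inj₁ (inPart (fwd ())))
      leg-adjacent inMiddle inMiddle (inj₁ (inPart (bwd ())))
      leg-adjacent inMiddle inFoot   (inj₁ (inPart (fwd (middle-foot _)))) = inFoot
      leg-adjacent inMiddle inFoot   (inj₁ (inPart (bwd ())))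
      leg-adjacent inFoot   inMiddle (inj₁ (inPart (fwd ())))
      leg-adjacent inFoot   inMiddle (inj₁ (inPart (bwd (middle-foot _)))) = inMiddle
      leg-adjacent inFoot   inFoot   (inj₁ (inPart (fwd ())))
      leg-adjacent inFoot   inFoot   (inj₁ (inPart (bwd ())))
      leg-adjacent x∈ y∈ (inj₂ (fwd (_ , eq))) =
        Sum.[ ⊥-elim ∘ center∉leg x∈ , ⊥-elim ∘ center∉leg y∈ ] (added-edge-has-center eq)
      leg-adjacent x∈ y∈ (inj₂ (bwd (_ , eq))) =
        Sum.[ ⊥-elim ∘ center∉leg y∈ , ⊥-elim ∘ center∉leg x∈ ] (added-edge-has-center eq)

      IsLegEdge : ∀ i → Fin (k i) → Edge G → Set
      IsLegEdge i j e = mid i j IsEnd e × ft i j IsEnd e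

      legEdge : ∀ i j → ∃[ e ] IsLegEdge i j e
      legEdge i j = edge-on (mid∼ft i j)

      mid≢ft : ∀ i j → mid i j ≢ ft i j
      mid≢ft i j = ∼⇒≢ (mid∼ft i j)

      isLegEdge? : Decidable (λ e → ∃[ i ] ∃[ j ] IsLegEdge i j e)
      isLegEdge? e = any? λ i → any? λ j → isEnd? (mid i j) e ×-dec isEnd? (ft i j) e

      M : EdgeSet G
      M = ⟦ isLegEdge? ⟧

      legEdge-end : ∀ {i j e x} → IsLegEdge i j e → x IsEnd e → InLeg i j (to x)
      legEdge-end {i} {j} {e} (m∈ , f∈) x∈ with third-end e m∈ f∈ (mid≢ft i j) x∈
      ... | inj₁ refl = subst (InLeg i j) (sym (Inverse.strictlyInverseˡ vertices _)) inMiddle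
      ... | inj₂ refl = subst (InLeg i j) (sym (Inverse.strictlyInverseˡ vertices _)) inFoot

      leg-unique : ∀ {i j i′ j′ x} → InLeg i j x → InLeg i′ j′ x → (i , j) ≡ (i′ , j′)
      leg-unique inMiddle inMiddle = refl
      leg-unique inFoot   inFoot   = refl

      legEdge-unique : ∀ {i j i′ j′ e f} → IsLegEdge i j e → IsLegEdge i′ j′ f → (i , j) ≡ (i′ , j′) → e ≡ f
      legEdge-unique {i} {j} {e = e} {f} (p , q) (p′ , q′) refl = edge-unique e f p q p′ q′ (mid≢ft i j)

      M-isInducedMatching : IsInducedMatching G M
      M-isInducedMatching =
        (λ e e∈ f f∈ e≢f (x , x∈e , x∈f) →
          let _ , _ , l = ∈⟦⟧⁻ isLegEdge? e∈ ; _ , _ , l′ = ∈⟦⟧⁻ isLegEdge? f∈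
          in e≢f (legEdge-unique l l′ (leg-unique (legEdge-end l x∈e) (legEdge-end l′ x∈f)))) ,
        (λ e e∈ f f∈ e≢f (g , j) →
          let _ , _ , l = ∈⟦⟧⁻ isLegEdge? e∈ ; _ , _ , l′ = ∈⟦⟧⁻ isLegEdge? f∈
              _ , _ , x∈e , y∈f , _ , _ , x∼y = joins⁻ g e f j
          in e≢f (legEdge-unique l l′ (leg-unique
               (leg-adjacent (legEdge-end l x∈e) (legEdge-end l′ y∈f) (≅-to-adj G≅T x∼y)) (legEdge-end l′ y∈f))))

      Pendant : ∀ i → Fin (k i) → Set
      Pendant i j = ∀ {y} → y ∼ ft i j → y ≡ mid i j

      -- A middle has two neighbours, and so does the center, because `2 ≤ k i`.
      leaf-of-spider : ∀ {i x} → 2 ≤ k i → IsLeaf (spider (k i)) x → ∃[ j ] x ≡ foot j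
      leaf-of-spider {i} {center} 2≤ki leaf with k i
      leaf-of-spider {i} {center} (s≤s (s≤s _)) leaf | suc (suc _)
        with () ← degree-1⇒≡ (spider _) leaf (fwd (center-middle zero)) (fwd (center-middle (suc zero)))
      leaf-of-spider {i} {middle j} _ leaf
        with () ← degree-1⇒≡ (spider _) leaf (fwd (middle-foot j)) (bwd (center-middle j))
      leaf-of-spider {i} {foot j} _ leaf = j , refl

      degree-1⇒pendant : ∀ {i j} → HasDegree T (i , foot j) 1 → Pendant i j
      degree-1⇒pendant {i} {j} deg {y} y∼f = trans (sym (strictlyInverseʳ y)) (cong from
        (degree-1⇒≡ T deg
          (≅-from-adj⁻ G≅T (subst (ft i j ∼_) (sym (strictlyInverseʳ y)) (∼-sym y∼f)))
          (inj₁ (inPart (bwd (middle-foot j))))))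

      two-pendants : ∀ i → ∃[ j ] ∃[ j′ ] (j ≢ j′ × Pendant i j × Pendant i j′)
      two-pendants i with C2 i
      ... | x , y , x≢y , lx , ly , dx , dy with leaf-of-spider {i} (2≤k i) lx | leaf-of-spider {i} (2≤k i) ly
      ... | j , refl | j′ , refl = j , j′ , x≢y ∘ cong foot , degree-1⇒pendant dx , degree-1⇒pendant dy

      module _ {B : EdgeSet G} (eop : IsEOP G B) where

        PrivateEnd : Edge G → Fin n → Set
        PrivateEnd e x = x IsEnd e × (∀ {f} → f ∈ B → x IsEnd f → f ≡ e)

        -- If further edges `f` and `g` of `B` met the two ends of `e`, then `e` would join them.
        -- They are distinct, since an edge through both ends of `e` is `e` itself.
        privateEnd : ∀ {e} → e ∈ B → ∃[ x ] PrivateEnd e x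
        privateEnd {e} e∈ with any? (λ f → (f ∈? B) ×-dec isEnd? (end₁ G e) f ×-dec ¬? (f ≟ᶠ e))
        ... | no none = end₁ G e , inj₁ refl , λ {f} f∈ x∈f → case f ≟ᶠ e of λ where
                (yes f≡e) → f≡e
                (no f≢e) → contradiction (f , f∈ , x∈f , f≢e) none
        ... | yes (f , f∈ , x∈f , f≢e) = end₂ G e , inj₂ refl , λ {g} g∈ y∈g → case g ≟ᶠ e of λ where
                (yes g≡e) → g≡e
                (no g≢e) → contradiction
                  (e , f≢e ∘ sym , g≢e ∘ sym ,
                   joins⁺ e f g x∈f y∈g (inj₁ refl) (inj₂ refl) (∼⇒≢ (ends-adjacent e)))
                  (eop f f∈ g g∈ λ { refl → f≢e (edge-unique f e x∈f y∈g (inj₁ refl) (inj₂ refl) (∼⇒≢ (ends-adjacent e))) })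

        data ChargedTo (e : Edge G) (i : Fin (suc r)) (j : Fin (k i)) : Set where
          via-middle : PrivateEnd e (mid i j) → ChargedTo e i j
          via-foot   : PrivateEnd e (ft i j) → ChargedTo e i j
          via-center : PrivateEnd e (ctr i) → ¬ (mid i j IsEnd e) → Pendant i j → ChargedTo e i j

        charge : ∀ {e} → e ∈ B → ∃[ i ] ∃[ j ] ChargedTo e i j
        charge {e} e∈ with privateEnd e∈
        ... | x , px with to x | strictlyInverseʳ x
        ... | i , middle j | refl = i , j , via-middle px
        ... | i , foot j   | refl = i , j , via-foot px
        ... | i , center   | refl with two-pendants i
        ... | j , j′ , j≢j′ , pj , pj′ with isEnd? (mid i j) e
        ... | no m∉e = i , j , via-center px m∉e pj
        ... | yes m∈e = i , j′ , via-center px m′∉e pj′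
          where
          m′∉e : ¬ (mid i j′ IsEnd e)
          m′∉e m′∈e with third-end e (proj₁ px) m∈e (∼⇒≢ (ctr∼mid i j)) m′∈e
          ... | inj₁ eq = ∼⇒≢ (ctr∼mid i j′) (sym eq)
          ... | inj₂ eq with refl ← ≅-from-injective G≅T eq = j≢j′ refl

        -- The edge from the center to the middle joins `e` to `f`. It is not `e`, and if it were
        -- `f`, the private end of `e` would lie on `f`.
        center-middle-end : ∀ {e f i j} → e ∈ B → f ∈ B → PrivateEnd e (ctr i) → ¬ (mid i j IsEnd e) →
                            mid i j IsEnd f → e ≡ f
        center-middle-end {i = i} {j} e∈ f∈ (c∈e , unique) m∉e m∈f
          with EOP-adjacent eop e∈ f∈ c∈e m∈f (ctr∼mid i j)
        ... | inj₁ e≡f = e≡f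
        ... | inj₂ (inj₁ m∈e) = contradiction m∈e m∉e
        ... | inj₂ (inj₂ c∈f) = sym (unique f∈ c∈f)

        -- An edge at a pendant foot also ends at the middle, which leads back to
        -- `center-middle-end`. This is why centers are charged to pendant legs only.
        center-foot-end : ∀ {e f i j} → e ∈ B → f ∈ B → PrivateEnd e (ctr i) → ¬ (mid i j IsEnd e) →
                          Pendant i j → ft i j IsEnd f → e ≡ f
        center-foot-end {f = f} e∈ f∈ c m∉e pendant f∈f with other-end f f∈f
        ... | y , y∈f , f∼y = center-middle-end e∈ f∈ c m∉e (subst (_IsEnd f) (pendant (∼-sym f∼y)) y∈f)

        middle-foot-end : ∀ {e f i j} → e ∈ B → f ∈ B → PrivateEnd e (mid i j) → PrivateEnd f (ft i j) → e ≡ f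
        middle-foot-end {i = i} {j} e∈ f∈ (m∈e , unique) (f∈f , unique′)
          with EOP-adjacent eop e∈ f∈ m∈e f∈f (mid∼ft i j)
        ... | inj₁ e≡f = e≡f
        ... | inj₂ (inj₁ f∈e) = unique′ e∈ f∈e
        ... | inj₂ (inj₂ m∈f) = sym (unique f∈ m∈f)

        charge-injective : ∀ {e f i j} → e ∈ B → f ∈ B → ChargedTo e i j → ChargedTo f i j → e ≡ f
        charge-injective e∈ f∈ (via-middle (_ , u)) (via-middle (m∈f , _)) = sym (u f∈ m∈f)
        charge-injective e∈ f∈ (via-foot (_ , u)) (via-foot (m∈f , _)) = sym (u f∈ m∈f)
        charge-injective e∈ f∈ (via-center (_ , u) _ _) (via-center (m∈f , _) _ _) = sym (u f∈ m∈f)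
        charge-injective e∈ f∈ (via-middle p) (via-foot q) = middle-foot-end e∈ f∈ p q
        charge-injective e∈ f∈ (via-foot p) (via-middle q) = sym (middle-foot-end f∈ e∈ q p)
        charge-injective e∈ f∈ (via-center p m∉ _) (via-middle q) = center-middle-end e∈ f∈ p m∉ (proj₁ q)
        charge-injective e∈ f∈ (via-middle p) (via-center q m∉ _) = sym (center-middle-end f∈ e∈ q m∉ (proj₁ p))
        charge-injective e∈ f∈ (via-center p m∉ pd) (via-foot q) = center-foot-end e∈ f∈ p m∉ pd (proj₁ q)
        charge-injective e∈ f∈ (via-foot p) (via-center q m∉ pd) = sym (center-foot-end f∈ e∈ q m∉ pd (proj₁ p))

        ∣EOP∣≤∣M∣ : ∣ B ∣ ≤ ∣ M ∣
        ∣EOP∣≤∣M∣ = ∣∣-mono-rel (λ e m → ∃[ i ] ∃[ j ] (IsLegEdge i j m × ChargedTo e i j))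
          (λ e∈ → let i , j , c = charge e∈ ; m , l = legEdge i j
                  in m , ∈⟦⟧⁺ isLegEdge? (i , j , l) , i , j , l , c)
          (λ where
            e∈ f∈ (_ , _ , l , c) (_ , _ , l′ , c′) →
              case leg-unique (legEdge-end l (proj₁ l)) (legEdge-end l′ (proj₁ l)) of λ where
                refl → charge-injective e∈ f∈ c c′)

    𝓕⇒ρₑᵒ≡νᴵ : ρₑᵒ G ≡ νᴵ G
    𝓕⇒ρₑᵒ≡νᴵ = ℕₚ.≤-antisym
      (maxCard-≤ (isEOP? G) λ B eop → ℕₚ.≤-trans (∣EOP∣≤∣M∣ eop) (≤-maxCard (isInducedMatching? G) M M-isInducedMatching))
      νᴵ≤ρₑᵒ

-- Rooted trees

least : {P : ℕ → Set} → Decidable P → ∀ k → P k → ∃[ m ] (P m × (∀ j → P j → m ≤ j))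
least P? k Pk with P? 0
least P? k       Pk | yes P0 = 0 , P0 , λ _ _ → z≤n
least P? zero    Pk | no ¬P0 = contradiction Pk ¬P0
least P? (suc k) Pk | no ¬P0 with least (P? ∘ suc) k Pk
... | m , Pm , minimal = suc m , Pm , λ where
  zero    P0 → contradiction P0 ¬P0
  (suc j) Pj → s≤s (minimal j Pj)

bounded : (f : Fin n → ℕ) → ∃[ b ] (∀ x → f x < b)
bounded {zero}  f = 0 , λ ()
bounded {suc n} f with bounded (f ∘ suc)
... | b , f<b = suc (f zero) + b , λ where
  zero    → ℕₚ.m≤m+n _ b
  (suc x) → ℕₚ.<-≤-trans (f<b x) (ℕₚ.m≤n+m b _)

-- The list records all visited vertices with both ends, ready to be matched against `IsCycle`.
data Walk {V : Set} (R : V → V → Set) : V → V → List V → Set where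
  end  : ∀ {x} → Walk R x x [ x ]
  step : ∀ {x y z xs} → R x y → Walk R y z xs → Walk R x z (x ∷ xs)

module _ {V : Set} {R : V → V → Set} where

  Walk-snoc : ∀ {x y z xs} → Walk R x y xs → R y z → Walk R x z (xs ++ [ z ])
  Walk-snoc end        r = step r end
  Walk-snoc (step s w) r = step s (Walk-snoc w r)

  Walk⇒Linked : ∀ {x y xs} → Walk R x y xs → Linked R xs
  Walk⇒Linked end = [-]
  Walk⇒Linked (step r end)          = r ∷ [-]
  Walk⇒Linked (step r w@(step _ _)) = r ∷ Walk⇒Linked w

  Walk-nonempty : ∀ {x y xs} → Walk R x y xs → 1 ≤ length xs
  Walk-nonempty end        = s≤s z≤n
  Walk-nonempty (step _ _) = s≤s z≤n

  Walk-≢⇒2≤ : ∀ {x y xs} → Walk R x y xs → x ≢ y → 2 ≤ length xs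
  Walk-≢⇒2≤ end        x≢x = contradiction refl x≢x
  Walk-≢⇒2≤ (step _ w) _   = s≤s (Walk-nonempty w)

-- Acyclicity is expressed by `adj-par`: every edge joins a vertex to its parent. With the
-- convention `par-root`, `Needy (par root) root` refers to the whole tree.
record Rooted (G : Graph (Fin n)) (root : Fin n) : Set where
  field
    par         : Fin n → Fin n
    depth       : Fin n → ℕ
    par-root    : par root ≡ root
    depth-par   : ∀ {x} → x ≢ root → depth x ≡ suc (depth (par x))
    par-adj     : ∀ {x} → x ≢ root → Adj G x (par x)
    adj-par     : ∀ {x y} → Adj G x y → (x ≢ root × par x ≡ y) ⊎ (y ≢ root × par y ≡ x)

module _ (G : Graph (Fin n)) (isTree : IsTree G) (root : Fin n) where
  open Edges G
  open IsTree isTree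

  private
    ReachIn : ℕ → Fin n → Set
    ReachIn zero    x = x ≡ root
    ReachIn (suc k) x = ∃[ y ] (x ∼ y × ReachIn k y)

    reachIn? : ∀ k → Decidable (ReachIn k)
    reachIn? zero    x = x ≟ᶠ root
    reachIn? (suc k) x = any? λ y → adj? G x y ×-dec reachIn? k y

    Star⇒ReachIn : ∀ {x} → Star _∼_ x root → ∃[ k ] ReachIn k x
    Star⇒ReachIn ε        = 0 , refl
    Star⇒ReachIn (x∼y ◅ s) = let k , r = Star⇒ReachIn s in suc k , _ , x∼y , r

    distance : ∀ x → ∃[ k ] (ReachIn k x × (∀ j → ReachIn j x → k ≤ j))
    distance x = let k , r = Star⇒ReachIn (connected x root) in least (λ j → reachIn? j x) k r

    depth : Fin n → ℕ
    depth x = proj₁ (distance x)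

    reach : ∀ x → ReachIn (depth x) x
    reach x = proj₁ (proj₂ (distance x))

    depth-minimal : ∀ {x} j → ReachIn j x → depth x ≤ j
    depth-minimal j = proj₂ (proj₂ (distance _)) j

    depth-adj : ∀ {x y} → x ∼ y → depth x ≤ suc (depth y)
    depth-adj x∼y = depth-minimal _ (_ , x∼y , reach _)

    parent : ∀ x → x ≢ root → ∃[ y ] (x ∼ y × depth x ≡ suc (depth y))
    parent x x≢root with depth x in eq | reach x
    ... | zero  | x≡root = contradiction x≡root x≢root
    ... | suc k | y , x∼y , r = y , x∼y , ℕₚ.≤-antisym
      (subst (_≤ suc (depth y)) eq (depth-adj x∼y)) (s≤s (depth-minimal k r))

    depth-0 : ∀ {x} → depth x ≡ 0 → x ≡ root
    depth-0 {x} eq = subst (λ k → ReachIn k x) eq (reach x)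

    -- The decision is an argument so that facts about `par` can be proved for an arbitrary
    -- decision.
    parentOr : ∀ x → Dec (x ≡ root) → Fin n
    parentOr x (yes _)     = root
    parentOr x (no x≢root) = proj₁ (parent x x≢root)

    par : Fin n → Fin n
    par x = parentOr x (x ≟ᶠ root)

    par-root : par root ≡ root
    par-root = at-root (root ≟ᶠ root)
      where
      at-root : ∀ d → parentOr root d ≡ root
      at-root (yes _) = refl
      at-root (no root≢root) = contradiction refl root≢root

    par-spec : ∀ {x} → x ≢ root → x ∼ par x × depth x ≡ suc (depth (par x))
    par-spec {x} x≢root = off-root (x ≟ᶠ root)
      where
      off-root : ∀ d → x ∼ parentOr x d × depth x ≡ suc (depth (parentOr x d))
      off-root (yes x≡root) = contradiction x≡root x≢root
      off-root (no x≢root)  = proj₂ (parent x x≢root)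

    positive-depth⇒≢root : ∀ {x d} → depth x ≡ suc d → x ≢ root
    positive-depth⇒≢root eq refl = ℕₚ.1+n≢0 (trans (sym eq) (ℕₚ.n≤0⇒n≡0 (depth-minimal 0 refl)))

    par-unless-zero : ∀ {x d} → depth x ≡ suc d → x ∼ par x × depth (par x) ≡ d
    par-unless-zero eq with par-spec (positive-depth⇒≢root eq)
    ... | x∼p , x≡1+p = x∼p , ℕₚ.suc-injective (trans (sym x≡1+p) eq)

    ≢-of-depth : ∀ {x k} {ys : List (Fin n)} → k < depth x → All (λ y → depth y ≤ k) ys → All (x ≢_) ys
    ≢-of-depth k<x = All.map λ y≤k → λ { refl → ℕₚ.<⇒≱ k<x y≤k }

    -- Both vertices ascend to their parents until they meet, at the root at the latest. The depth
    -- bound keeps new ends off the walk between the parents.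
    level-walk : ∀ d {y z} → depth y ≡ d → depth z ≡ d →
                 ∃[ xs ] (Walk _∼_ y z xs × Unique xs × All (λ x → depth x ≤ d) xs)
    level-walk d {y} {z} y≡d z≡d with y ≟ᶠ z
    level-walk d {y} {z} y≡d z≡d | yes refl = [ y ] , end , [] ∷ [] , ℕₚ.≤-reflexive y≡d ∷ []
    level-walk zero y≡0 z≡0 | no y≢z = contradiction (trans (depth-0 y≡0) (sym (depth-0 z≡0))) y≢z
    level-walk (suc d) {y} {z} y≡d z≡d | no y≢z with par-unless-zero y≡d | par-unless-zero z≡d
    ... | y∼p , p≡d | z∼q , q≡d with level-walk d p≡d q≡d
    ... | xs , w , u , low =
      y ∷ xs ++ [ z ] , step y∼p (Walk-snoc w (∼-sym z∼q)) ,
      Allₚ.++⁺ (≢-of-depth (ℕₚ.≤-reflexive (sym y≡d)) low) (y≢z ∷ []) ∷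
        Uniqueₚ.++⁺ u ([] ∷ []) (λ { (v∈ , here refl) →
          All.lookup (≢-of-depth (ℕₚ.≤-reflexive (sym z≡d)) low) v∈ refl }) ,
      ℕₚ.≤-reflexive y≡d ∷ Allₚ.++⁺ (All.map ℕₚ.m≤n⇒m≤1+n low) (ℕₚ.≤-reflexive z≡d ∷ [])

    -- Such an edge and the edges to the parents of its ends would close the level walk between
    -- these parents into a cycle, a triangle if the parents coincide.
    no-level-edge : ∀ {x y} → x ∼ y → depth x ≢ depth y
    no-level-edge {x} {y} x∼y eq with depth y in y≡d
    ... | zero = ∼⇒≢ x∼y (trans (depth-0 eq) (sym (depth-0 y≡d)))
    ... | suc d with par-unless-zero eq | par-unless-zero y≡d
    ... | x∼p , p≡d | y∼q , q≡d with level-walk d p≡d q≡d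
    ... | xs , w , u , low = acyclic x (xs ++ [ y ])
      ( subst (2 ≤_) (sym (Listₚ.length-++ xs)) (ℕₚ.+-mono-≤ (Walk-nonempty w) (s≤s z≤n))
      , Allₚ.++⁺ (≢-of-depth (ℕₚ.≤-reflexive (sym eq)) low) (∼⇒≢ x∼y ∷ []) ∷
          Uniqueₚ.++⁺ u ([] ∷ []) (λ { (v∈ , here refl) →
            All.lookup (≢-of-depth (ℕₚ.≤-reflexive (sym y≡d)) low) v∈ refl })
      , Walk⇒Linked (step x∼p (Walk-snoc (Walk-snoc w (∼-sym y∼q)) (∼-sym x∼y))))

    -- Two parents would be joined by a level walk, which avoids the deeper vertex `x`; so `x` would
    -- close it into a cycle.
    parent-unique : ∀ {x y z} → x ∼ y → x ∼ z → depth x ≡ suc (depth y) → depth x ≡ suc (depth z) → y ≡ z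
    parent-unique {x} {y} {z} x∼y x∼z x≡y x≡z with y ≟ᶠ z
    ... | yes y≡z = y≡z
    ... | no y≢z with level-walk (depth y) refl (ℕₚ.suc-injective (trans (sym x≡z) x≡y))
    ... | xs , w , u , low = contradiction
      ( Walk-≢⇒2≤ w y≢z
      , ≢-of-depth (ℕₚ.≤-reflexive (sym x≡y)) low ∷ u
      , Walk⇒Linked (step x∼y (Walk-snoc w (∼-sym x∼z))))
      (acyclic x xs)

    deeper⇒child : ∀ {x y} → x ∼ y → depth y < depth x → x ≢ root × par x ≡ y
    deeper⇒child {x} {y} x∼y y<x = x≢root ,
      parent-unique (proj₁ (par-spec x≢root)) x∼y (proj₂ (par-spec x≢root)) (ℕₚ.≤-antisym (depth-adj x∼y) y<x)
      where
      x≢root : x ≢ root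
      x≢root refl = ℕₚ.n≮0 (ℕₚ.<-≤-trans y<x (depth-minimal 0 refl))

    adj-par : ∀ {x y} → x ∼ y → (x ≢ root × par x ≡ y) ⊎ (y ≢ root × par y ≡ x)
    adj-par {x} {y} x∼y with ℕₚ.<-cmp (depth x) (depth y)
    ... | tri< x<y _ _ = inj₂ (deeper⇒child (∼-sym x∼y) x<y)
    ... | tri≈ _ x≡y _ = contradiction x≡y (no-level-edge x∼y)
    ... | tri> _ _ y<x = inj₁ (deeper⇒child x∼y y<x)

  rootAt : Rooted G root
  rootAt = record
    { par       = par
    ; depth     = depth
    ; par-root  = par-root
    ; depth-par = λ x≢root → proj₂ (par-spec x≢root)
    ; par-adj   = λ x≢root → proj₁ (par-spec x≢root)
    ; adj-par   = adj-par
    }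

-- Matchings in rooted trees

module RootedTree {G : Graph (Fin n)} {root : Fin n} (rooted : Rooted G root) where
  open Rooted rooted public
  open Edges G

  infix 4 _◂_

  -- `x` is a child of `y`; the first component excludes the conventional parent of the root.
  _◂_ : Fin n → Fin n → Set
  x ◂ y = x ≢ root × par x ≡ y

  _◂?_ : ∀ x y → Dec (x ◂ y)
  x ◂? y = ¬? (x ≟ᶠ root) ×-dec (par x ≟ᶠ y)

  ◂par : ∀ {x} → x ≢ root → x ◂ par x
  ◂par x≢root = x≢root , refl

  ◂⇒∼ : ∀ {x y} → x ◂ y → x ∼ y
  ◂⇒∼ (x≢root , refl) = par-adj x≢root

  ◂-depth : ∀ {x y} → x ◂ y → depth x ≡ suc (depth y)
  ◂-depth (x≢root , refl) = depth-par x≢root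

  ◂-asym : ∀ {x y} → x ◂ y → ¬ (y ◂ x)
  ◂-asym x◂y y◂x = ℕₚ.<-asym (ℕₚ.≤-reflexive (sym (◂-depth x◂y))) (ℕₚ.≤-reflexive (sym (◂-depth y◂x)))

  ◂-functional : ∀ {x y z} → x ◂ y → x ◂ z → y ≡ z
  ◂-functional (_ , refl) (_ , refl) = refl

  ∼⇒child : ∀ {x y} → x ∼ y → y ≢ par x → y ◂ x
  ∼⇒child x∼y y≢px with adj-par x∼y
  ... | inj₁ (_ , px≡y) = contradiction (sym px≡y) y≢px
  ... | inj₂ y◂x = y◂x

  child-of-edge : ∀ e {x y} → x ≢ root → x IsEnd e → par x IsEnd e → y ≢ root → y IsEnd e → par y IsEnd e → x ≡ y
  child-of-edge e x≢root x∈ px∈ y≢root y∈ py∈ with third-end e x∈ px∈ (∼⇒≢ (par-adj x≢root)) y∈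
  ... | inj₁ y≡x = sym y≡x
  ... | inj₂ refl with third-end e x∈ px∈ (∼⇒≢ (par-adj x≢root)) py∈
  ... | inj₁ ppx≡x = contradiction (y≢root , ppx≡x) (◂-asym (◂par x≢root))
  ... | inj₂ ppx≡px = contradiction (sym ppx≡px) (∼⇒≢ (par-adj y≢root))

module InducedMatching {G : Graph (Fin n)} {M : EdgeSet G} (ind : IsInducedMatching G M) where
  open Edges G

  Mt : Fin n → Fin n → Set
  Mt x y = x ≢ y × ∃[ e ] (e ∈ M × x IsEnd e × y IsEnd e)

  mt? : ∀ x y → Dec (Mt x y)
  mt? x y = ¬? (x ≟ᶠ y) ×-dec any? λ e → (e ∈? M) ×-dec isEnd? x e ×-dec isEnd? y e

  Mt-sym : ∀ {x y} → Mt x y → Mt y x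
  Mt-sym (x≢y , e , e∈ , x∈ , y∈) = x≢y ∘ sym , e , e∈ , y∈ , x∈

  Mt⇒∼ : ∀ {x y} → Mt x y → x ∼ y
  Mt⇒∼ (x≢y , e , _ , x∈ , y∈) = ends-adjacent′ e x∈ y∈ x≢y

  Mt-functional : ∀ {x y z} → Mt x y → Mt x z → y ≡ z
  Mt-functional {x} (x≢y , e , e∈ , x∈e , y∈e) (x≢z , f , f∈ , x∈f , z∈f) with e ≟ᶠ f
  ... | no e≢f = contradiction (x , x∈e , x∈f) (proj₁ ind e e∈ f f∈ e≢f)
  ... | yes refl with third-end e x∈e y∈e x≢y z∈f
  ...   | inj₁ z≡x = contradiction (sym z≡x) x≢z
  ...   | inj₂ z≡y = sym z≡y

  -- Otherwise the edge `xy` would join two distinct edges of `M`.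
  Mt-induced : ∀ {x x′ y y′} → Mt x x′ → Mt y y′ → x ∼ y → Mt x y
  Mt-induced (_ , e , e∈ , x∈e , _) (_ , f , f∈ , y∈f , _) x∼y with e ≟ᶠ f
  ... | yes refl = ∼⇒≢ x∼y , e , e∈ , x∈e , y∈f
  ... | no e≢f = let g , x∈g , y∈g = edge-on x∼y in
    contradiction (g , joins⁺ g e f x∈e y∈f x∈g y∈g (∼⇒≢ x∼y)) (proj₂ ind e e∈ f f∈ e≢f)

  Covered : Fin n → Set
  Covered x = ∃[ y ] Mt x y

  covered? : Decidable Covered
  covered? x = any? (mt? x)

  mate : Fin n → Fin n
  mate x with covered? x
  ... | yes (y , _) = y
  ... | no _        = x

  Mt-mate : ∀ {x} → Covered x → Mt x (mate x)
  Mt-mate {x} cov with covered? x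
  ... | yes (_ , m) = m
  ... | no ¬cov     = contradiction cov ¬cov

  mate-unique : ∀ {x y} → Mt x y → mate x ≡ y
  mate-unique m = Mt-functional (Mt-mate (_ , m)) m

  covered-adjacent : ∀ {x y} → Covered x → Covered y → x ∼ y → Mt x y
  covered-adjacent (_ , m) (_ , m′) = Mt-induced m m′

module RootedMatching {G : Graph (Fin n)} {M : EdgeSet G} (ind : IsInducedMatching G M)
                      {root : Fin n} (rooted : Rooted G root) where
  open Edges G
  open InducedMatching {G = G} {M} ind public
  open RootedTree rooted public

  -- Every edge of `M` has a bottom as its lower and a top as its upper end, so bottoms stand for
  -- the edges of `M` when these are counted.
  Bottom : Fin n → Set
  Bottom b = Mt b (par b)

  bottom? : Decidable Bottom
  bottom? b = mt? b (par b)

  Top : Fin n → Set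
  Top t = Covered t × ¬ Bottom t

  top? : Decidable Top
  top? t = covered? t ×-dec ¬? (bottom? t)

  data Kind (x : Fin n) : Set where
    is-uncovered : ¬ Covered x → Kind x
    is-top       : Top x → Kind x
    is-bottom    : Bottom x → Kind x

  kind : ∀ x → Kind x
  kind x with covered? x | bottom? x
  ... | no ¬cov | _       = is-uncovered ¬cov
  ... | yes cov | yes bot = is-bottom bot
  ... | yes cov | no ¬bot = is-top (cov , ¬bot)

  Bottom⇒Covered : ∀ {b} → Bottom b → Covered b
  Bottom⇒Covered bot = _ , bot

  Bottom⇒≢root : ∀ {b} → Bottom b → b ≢ root
  Bottom⇒≢root (b≢pb , _) refl = b≢pb (sym par-root)

  Bottom⇒◂ : ∀ {b} → Bottom b → b ◂ par b
  Bottom⇒◂ bot = ◂par (Bottom⇒≢root bot)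

  Bottom⇒Top-par : ∀ {b} → Bottom b → Top (par b)
  Bottom⇒Top-par {b} bot = (b , Mt-sym bot) , λ bot′ →
    ◂-asym (Bottom⇒◂ bot) (Bottom⇒≢root bot′ , Mt-functional bot′ (Mt-sym bot))

  mate-Bottom : ∀ {b} → Bottom b → mate b ≡ par b
  mate-Bottom bot = mate-unique bot

  mate-par-Bottom : ∀ {b} → Bottom b → mate (par b) ≡ b
  mate-par-Bottom bot = mate-unique (Mt-sym bot)

  Top⇒mate◂ : ∀ {t} → Top t → mate t ◂ t
  Top⇒mate◂ {t} (cov , ¬bot) = ∼⇒child (Mt⇒∼ (Mt-mate cov)) λ eq → ¬bot (subst (Mt t) eq (Mt-mate cov))

  par-mate : ∀ {t} → Top t → par (mate t) ≡ t
  par-mate top = proj₂ (Top⇒mate◂ top)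

  Top⇒mate-Bottom : ∀ {t} → Top t → Bottom (mate t)
  Top⇒mate-Bottom top = subst (Mt _) (sym (par-mate top)) (Mt-sym (Mt-mate (proj₁ top)))

  covered-child : ∀ {x y} → x ◂ y → Covered x → ¬ Covered y → Top x
  covered-child (_ , refl) cov ¬cov = cov , λ bot → ¬cov (_ , Mt-sym bot)

  covered-edge⇒Bottom : ∀ {x y} → x ◂ y → Covered x → Covered y → Bottom x
  covered-edge⇒Bottom x◂y@(_ , refl) cx cy = covered-adjacent cx cy (◂⇒∼ x◂y)

  par-of-Top : ∀ {t} → Top t → t ≢ root → ¬ Covered (par t)
  par-of-Top (cov , ¬bot) t≢root cov′ = ¬bot (covered-edge⇒Bottom (◂par t≢root) cov cov′)

  module Maximum (maximum : ∀ B → IsEOP G B → ∣ B ∣ ≤ ∣ M ∣) where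

    -- An X whose induced subgraph is a disjoint union of stars spans an EOP
    -- set; its edges are named by their lower ends.
    no-larger-star-forest :
      (X : Fin n → Set) → Decidable X →
      (∀ {x y} → X x → X y → x ◂ y → (∀ {w} → X w → w ∼ x → w ≡ y) ⊎ (∀ {w} → X w → w ∼ y → w ≡ x)) →
      (R : Fin n → Fin n → Set) →
      (∀ {b} → Bottom b → ∃[ y ] (y ≢ root × X y × X (par y) × R b y)) →
      (∀ {b b′ y} → R b y → R b′ y → b ≡ b′) →
      ∀ {z} → z ≢ root → X z → X (par z) → ¬ (∀ {b} → ¬ R b z)
    no-larger-star-forest X X? star R total injective {z} z≢root Xz Xpz z-new =
      -- `R` embeds the edges of `M`, named by their bottoms, into `B` and misses the edge above
      -- `z`, so `B` is larger than `M`.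
      ℕₚ.<⇒≱ (ℕₚ.≤-<-trans ∣M∣≤ (x∈p⇒∣p-x∣<∣p∣ z∈B)) (maximum B B-isEOP)
      where
      inside? : Decidable (λ e → X (end₁ G e) × X (end₂ G e))
      inside? e = X? (end₁ G e) ×-dec X? (end₂ G e)

      B : EdgeSet G
      B = ⟦ inside? ⟧

      end-in-X : ∀ {e x} → e ∈ B → x IsEnd e → X x
      end-in-X e∈ (inj₁ refl) = proj₁ (∈⟦⟧⁻ inside? e∈)
      end-in-X e∈ (inj₂ refl) = proj₂ (∈⟦⟧⁻ inside? e∈)

      ∈B : ∀ {e x y} → x IsEnd e → y IsEnd e → x ≢ y → X x → X y → e ∈ B
      ∈B {e} {x} {y} x∈ y∈ x≢y Xx Xy = ∈⟦⟧⁺ inside? (both (inj₁ refl) , both (inj₂ refl))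
        where
        both : ∀ {v} → v IsEnd e → X v
        both v∈ with third-end e x∈ y∈ x≢y v∈
        ... | inj₁ refl = Xx
        ... | inj₂ refl = Xy

      star′ : ∀ {x y} → X x → X y → x ∼ y → (∀ {w} → X w → w ∼ x → w ≡ y) ⊎ (∀ {w} → X w → w ∼ y → w ≡ x)
      star′ Xx Xy x∼y with adj-par x∼y
      ... | inj₁ x◂y = star Xx Xy x◂y
      ... | inj₂ y◂x = Sum.swap (star Xy Xx y◂x)

      only-edge : ∀ {e g x y} → e ∈ B → x IsEnd e → x IsEnd g → y IsEnd g → x ∼ y →
                  (∀ {w} → X w → w ∼ x → w ≡ y) → e ≡ g
      only-edge {e} {g} e∈ x∈e x∈g y∈g x∼y only with other-end e x∈e
      ... | w , w∈e , x∼w with refl ← only (end-in-X e∈ w∈e) (∼-sym x∼w) =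
        edge-unique e g x∈e w∈e x∈g y∈g (∼⇒≢ x∼y)

      B-isEOP : IsEOP G B
      B-isEOP e e∈ f f∈ e≢f (g , g≢e , g≢f , j) with joins⁻ g e f j
      ... | x , y , x∈e , y∈f , x∈g , y∈g , x∼y with star′ (end-in-X e∈ x∈e) (end-in-X f∈ y∈f) x∼y
      -- Where the only `X`-neighbour of an end of `g` lies across `g`, the edge of `B` at that end
      -- is `g` itself.
      ...   | inj₁ only-y = g≢e (sym (only-edge e∈ x∈e x∈g y∈g x∼y only-y))
      ...   | inj₂ only-x = g≢f (sym (only-edge f∈ y∈f y∈g x∈g (∼-sym x∼y) only-x))

      edge-z : ∃[ e ] (z IsEnd e × par z IsEnd e)
      edge-z = edge-on (par-adj z≢root)

      z∈B : proj₁ edge-z ∈ B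
      z∈B = ∈B (proj₁ (proj₂ edge-z)) (proj₂ (proj₂ edge-z)) (∼⇒≢ (par-adj z≢root)) Xz Xpz

      record Image (e f : Edge G) : Set where
        field
          {b y}  : Fin n
          bot    : Bottom b
          b∈     : b IsEnd e
          pb∈    : par b IsEnd e
          y≢root : y ≢ root
          y∈     : y IsEnd f
          py∈    : par y IsEnd f
          r      : R b y

      lower-end : ∀ {e} → e ∈ M → ∃[ b ] (Bottom b × b IsEnd e × par b IsEnd e)
      lower-end {e} e∈ with adj-par (ends-adjacent e)
      ... | inj₁ (p≢root , eq) = _ , (∼⇒≢ (par-adj p≢root) , e , e∈ , inj₁ refl , inj₂ eq) , inj₁ refl , inj₂ eq
      ... | inj₂ (p≢root , eq) = _ , (∼⇒≢ (par-adj p≢root) , e , e∈ , inj₂ refl , inj₁ eq) , inj₂ refl , inj₁ eq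

      image : ∀ {e} → e ∈ M → ∃[ f ] (f ∈ B - proj₁ edge-z × Image e f)
      image e∈ with lower-end e∈
      ... | b , bot , b∈ , pb∈ with total bot
      ... | y , y≢root , Xy , Xpy , r with edge-on (par-adj y≢root)
      ... | f , y∈ , py∈ = f , x∈p∧x≢y⇒x∈p-y (∈B y∈ py∈ (∼⇒≢ (par-adj y≢root)) Xy Xpy) f≢z , record
        { bot = bot ; b∈ = b∈ ; pb∈ = pb∈ ; y≢root = y≢root ; y∈ = y∈ ; py∈ = py∈ ; r = r }
        where
        f≢z : f ≢ proj₁ edge-z
        f≢z refl with refl ← child-of-edge f y≢root y∈ py∈ z≢root (proj₁ (proj₂ edge-z)) (proj₂ (proj₂ edge-z)) =
          z-new r

      ∣M∣≤ : ∣ M ∣ ≤ ∣ B - proj₁ edge-z ∣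
      ∣M∣≤ = ∣∣-mono-rel Image image λ {e} {e′} {f} _ _ i i′ → injective-image e e′ f i i′
        where
        injective-image : ∀ e e′ f → Image e f → Image e′ f → e ≡ e′
        injective-image e e′ f i i′ = edge-unique e e′ (Image.b∈ i) (Image.pb∈ i)
            (subst (_IsEnd e′) (sym b≡b′) (Image.b∈ i′)) (subst ((_IsEnd e′) ∘ par) (sym b≡b′) (Image.pb∈ i′))
            (∼⇒≢ (par-adj (Bottom⇒≢root (Image.bot i))))
          where
          y≡y′ = child-of-edge f (Image.y≢root i) (Image.y∈ i) (Image.py∈ i)
                                 (Image.y≢root i′) (Image.y∈ i′) (Image.py∈ i′)

          b≡b′ : Image.b i ≡ Image.b i′
          b≡b′ = injective (Image.r i) (subst (R _) (sym y≡y′) (Image.r i′))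

-- Exchange arguments

abstract
  -- Opaque, so that types never unfold the search; all that is known about the chosen element comes
  -- from `choose-cases`.
  choose : {P : Pred (Fin n) 0ℓ} → Decidable P → Fin n → Fin n
  choose P? default with any? P?
  ... | yes (x , _) = x
  ... | no _        = default

  choose-cases : {P : Pred (Fin n) 0ℓ} (P? : Decidable P) → ∀ default →
                 (choose P? default ≡ default × ¬ ∃ P) ⊎ P (choose P? default)
  choose-cases P? default with any? P?
  ... | yes (_ , Px) = inj₂ Px
  ... | no ¬∃P       = inj₁ (refl , ¬∃P)

choose-satisfies : {P : Pred (Fin n) 0ℓ} (P? : Decidable P) → ∀ default → ∃ P → P (choose P? default)
choose-satisfies P? default ∃P with choose-cases P? default
... | inj₁ (_ , ¬∃P) = contradiction ∃P ¬∃P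
... | inj₂ P-chosen  = P-chosen

-- Needy centers and claimed edges, without reference to a root

module Claims {G : Graph (Fin n)} {M : EdgeSet G} (ind : IsInducedMatching G M) where
  open Edges G
  open InducedMatching {G = G} {M} ind

  Pendant : Fin n → Set
  Pendant t = ∀ v → v ∼ mate t → v ≡ t

  pendant? : Decidable Pendant
  pendant? t = all? λ v → adj? G v (mate t) →-dec (v ≟ᶠ t)

  -- In the branch at u away from its neighbour p, at most one pendant matching
  -- edge next to u is not claimed from below: u needs the edge at p as well to
  -- become the center of a spider with two pendant legs.  For p = u the branch
  -- is the whole tree.
  data Needy (p u : Fin n) : Set

  Claimed : Fin n → Fin n → Set
  Claimed u t = ∃[ v ] (v ∼ t × ¬ Covered v × v ≢ u × Needy t v)

  data Needy p u where
    needy : ∀ c → Covered c → c ∼ u → c ≢ p →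
            (∀ t → Covered t → t ∼ u → t ≢ p → t ≢ c → Pendant t → Claimed u t) → Needy p u

  -- Only neighbours and branches occur, so a spare found with the root at `u` remains one under any
  -- other rooting.
  Spare : Fin n → Fin n → Set
  Spare u t = t ∼ u × Covered t × Pendant t × ¬ Claimed u t

module RootedClaims {G : Graph (Fin n)} {M : EdgeSet G} (ind : IsInducedMatching G M)
                    {root : Fin n} (rooted : Rooted G root) where
  open Edges G
  open RootedMatching {G = G} {M} ind rooted public
  open Claims {G = G} {M} ind public

  ◂⇒≢par : ∀ {x y} → x ◂ y → x ≢ par y
  ◂⇒≢par {y = y} x◂y refl with y ≟ᶠ root
  ... | yes refl = proj₁ x◂y par-root
  ... | no y≢root = ◂-asym x◂y (◂par y≢root)

  private
    claimed-if : ∀ {u t} → t ◂ u → (∀ {v} → v ◂ t → Dec (Needy (par v) v)) → Dec (Claimed u t)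
    claimed-if {u} {t} t◂u needy?′ = any? claims?
      where
      claims? : ∀ v → Dec (v ∼ t × ¬ Covered v × v ≢ u × Needy t v)
      claims? v with v ◂? t
      ... | no ¬v◂t = no λ (v∼t , _ , v≢u , _) → ¬v◂t (∼⇒child (∼-sym v∼t) (subst (v ≢_) (sym (proj₂ t◂u)) v≢u))
      ... | yes v◂t = adj? G v t ×-dec ¬? (covered? v) ×-dec ¬? (v ≟ᶠ u) ×-dec
                      subst (λ p → Dec (Needy p v)) (proj₂ v◂t) (needy?′ v◂t)

    bound : ∃[ b ] (∀ x → depth x < b)
    bound = bounded depth

    -- Neediness of `u` depends on vertices two levels further down, so `k` serves as fuel: at
    -- `zero` the depth of `u` would reach the bound.
    needy-within : ∀ k u → proj₁ bound ≤ depth u + k → Dec (Needy (par u) u)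
    needy-within zero u b≤ = contradiction (proj₂ bound u) 
      (ℕₚ.≤⇒≯ (subst (proj₁ bound ≤_) (ℕₚ.+-identityʳ (depth u)) b≤))
    needy-within (suc k) u b≤ = map′
      (λ (c , cov , c∼u , c≢p , claims) → needy c cov c∼u c≢p claims)
      (λ { (needy c cov c∼u c≢p claims) → c , cov , c∼u , c≢p , claims })
      (any? λ c → covered? c ×-dec adj? G c u ×-dec ¬? (c ≟ᶠ par u) ×-dec all? (claims? c))
      where
      claims? : ∀ c t → Dec (Covered t → t ∼ u → t ≢ par u → t ≢ c → Pendant t → Claimed u t)
      claims? c t with t ◂? u
      ... | no ¬t◂u = yes λ _ t∼u t≢p → contradiction (∼⇒child (∼-sym t∼u) t≢p) ¬t◂u
      ... | yes t◂u = covered? t →-dec adj? G t u →-dec ¬? (t ≟ᶠ par u) →-dec ¬? (t ≟ᶠ c) →-dec pendant? t →-dec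
        claimed-if t◂u λ {v} v◂t → needy-within k v (ℕₚ.≤-trans b≤ (begin
          depth u + suc k      ≡⟨ ℕₚ.+-suc (depth u) k ⟩
          suc (depth u) + k    ≡⟨ cong (_+ k) (sym (◂-depth t◂u)) ⟩
          depth t + k          ≤⟨ ℕₚ.+-monoˡ-≤ k (ℕₚ.n≤1+n (depth t)) ⟩
          suc (depth t) + k    ≡⟨ cong (_+ k) (sym (◂-depth v◂t)) ⟩
          depth v + k          ∎))
        where open ℕₚ.≤-Reasoning

  abstract
    needy? : ∀ u → Dec (Needy (par u) u)
    needy? u = needy-within (proj₁ bound) u (ℕₚ.m≤n+m _ (depth u))

  claimed? : ∀ {u t} → t ◂ u → Dec (Claimed u t)
  claimed? t◂u = claimed-if t◂u λ {v} _ → needy? v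

  -- `Spare` restricted to children of `u`, where `claimed?` can decide it. At the root all
  -- neighbours are children.
  Available : Fin n → Fin n → Set
  Available u t = t ◂ u × Covered t × Pendant t × ¬ Claimed u t

  available? : ∀ u → Decidable (Available u)
  available? u t with t ◂? u
  ... | no ¬t◂u = no (¬t◂u ∘ proj₁)
  ... | yes t◂u = (t ◂? u) ×-dec covered? t ×-dec pendant? t ×-dec ¬? (claimed? t◂u)

  -- If every available child were `c`, then `c` would be a witness for the constructor `needy`.
  available-≢ : ∀ {u} → ¬ Needy (par u) u → ∀ c → c ◂ u → Covered c → ∃[ t ] (Available u t × t ≢ c)
  available-≢ {u} ¬needy c c◂u cov with any? (λ t → available? u t ×-dec ¬? (t ≟ᶠ c))
  ... | yes found = found
  ... | no none = contradiction (needy c cov (◂⇒∼ c◂u) (◂⇒≢par c◂u) claims) ¬needy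
    where
    claims : ∀ t → Covered t → t ∼ u → t ≢ par u → t ≢ c → Pendant t → Claimed u t
    claims t cov t∼u t≢p t≢c pendant with ∼⇒child (∼-sym t∼u) t≢p
    ... | t◂u with claimed? t◂u
    ...   | yes claimed = claimed
    ...   | no ¬claimed = contradiction (t , (t◂u , cov , pendant , ¬claimed) , t≢c) none

  -- `available-≢` is applied twice: first to exclude `c`, which need not be available itself, and
  -- then to exclude the `t` so found.
  two-available : ∀ {u} → ¬ Needy (par u) u → (∃[ c ] (c ◂ u × Covered c)) →
                  ∃[ t ] ∃[ t′ ] (t ≢ t′ × Available u t × Available u t′)
  two-available ¬needy (c , c◂u , cov) with available-≢ ¬needy c c◂u cov
  ... | t , avail , _ with available-≢ ¬needy t (proj₁ avail) (proj₁ (proj₂ avail))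
  ...   | t′ , avail′ , t′≢t = t , t′ , t′≢t ∘ sym , avail , avail′

  HasChild : Fin n → Set
  HasChild b = ∃[ v ] v ◂ b

  hasChild? : Decidable HasChild
  hasChild? b = any? λ v → v ◂? b

  childless⇒pendant : ∀ {t} → Top t → ¬ HasChild (mate t) → Pendant t
  childless⇒pendant top childless v v∼m with adj-par v∼m
  ... | inj₁ v◂m = contradiction (v , v◂m) childless
  ... | inj₂ m◂v = ◂-functional m◂v (Top⇒mate◂ top)

  module MaximumAt (maximum : ∀ B → IsEOP G B → ∣ B ∣ ≤ ∣ M ∣) (root-uncovered : ¬ Covered root) where
    open Maximum maximum

    Top⇒≢root : ∀ {t} → Top t → t ≢ root
    Top⇒≢root top refl = root-uncovered (proj₁ top)

    -- If `v` were covered, it would be matched with `b`, whose mate is its parent.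
    child-of-Bottom : ∀ {v b} → v ◂ b → Bottom b → ¬ Covered v
    child-of-Bottom {v} v◂b@(_ , refl) bot cov = ◂-asym v◂b (subst (par v ◂_) (sym v≡pb) (Bottom⇒◂ bot))
      where
      v≡pb : v ≡ par (par v)
      v≡pb = Mt-functional (Mt-sym (covered-edge⇒Bottom v◂b cov (Bottom⇒Covered bot))) bot

    -- The X below trades, for every claimed edge that is given up, a star with
    -- center hub u for a claimant u, and gains one more star at hub root.  An
    -- edge t b that is given up without being pendant is replaced by the star
    -- at a child w of b.
    module Swap (root-needy : Needy (par root) root) where

      -- The default is not reached where it matters: a lost pendant edge lies below a needy center
      -- and hence has a claimant.
      claimant : Fin n → Fin n
      claimant t = choose (λ v → (v ◂? t) ×-dec ¬? (covered? v) ×-dec needy? v) t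

      relay : Fin n → Fin n
      relay b = choose (λ v → v ◂? b) b

      -- The witness inside the proof of neediness. The explicit decision lets `hub-spec` argue by
      -- cases on it.
      hubOf : ∀ {u} → Dec (Needy (par u) u) → Fin n
      hubOf (yes (needy c _ _ _ _)) = c
      hubOf {u} (no _)              = u

      hub : Fin n → Fin n
      hub u = hubOf (needy? u)

      hub-spec : ∀ {u} → Needy (par u) u → hub u ◂ u × Covered (hub u) ×
                 (∀ {t} → Top t → t ◂ u → t ≢ hub u → Pendant t →
                  claimant t ◂ t × ¬ Covered (claimant t) × Needy (par (claimant t)) (claimant t))
      hub-spec {u} nd = by-cases (needy? u)
        where
        by-cases : ∀ d → hubOf d ◂ u × Covered (hubOf d) × (∀ {t} → Top t → t ◂ u → t ≢ hubOf d → Pendant t →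
                   claimant t ◂ t × ¬ Covered (claimant t) × Needy (par (claimant t)) (claimant t))
        by-cases (no ¬nd) = contradiction nd ¬nd
        by-cases (yes (needy c cov c∼u c≢p claims)) = ∼⇒child (∼-sym c∼u) c≢p , cov , λ {t} top t◂u t≢c pendant →
          let v , v∼t , ¬cov , v≢u , nd′ = claims t (proj₁ top) (◂⇒∼ t◂u) (◂⇒≢par t◂u) t≢c pendant
              v◂t = ∼⇒child (∼-sym v∼t) (subst (v ≢_) (sym (proj₂ t◂u)) v≢u)
          in choose-satisfies (λ v → (v ◂? t) ×-dec ¬? (covered? v) ×-dec needy? v) t
               (v , v◂t , ¬cov , subst (λ p → Needy p v) (sym (proj₂ v◂t)) nd′)

      -- The centers whose hub edge enters the new EOP set: the root and, recursively, the claimants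
      -- of lost pendant edges.
      data U : Fin n → Set

      -- A center in `U` keeps its hub as the only covered child: with a second one, the edge to the
      -- hub would lie between that child's edge and the matching edge of the hub.
      Lost : Fin n → Set
      Lost t = Top t × U (par t) × t ≢ hub (par t)

      data U where
        u-root : U root
        u-step : ∀ {t} → Lost t → Pendant t → U (claimant t)

      -- Neediness propagates along lost pendant edges: apart from the hub, every pendant edge below
      -- a needy center is claimed by a needy one.
      U-spec : ∀ {u} → U u → ¬ Covered u × Needy (par u) u
      U-spec u-root = root-uncovered , root-needy
      U-spec (u-step (top , Up , t≢hub) pendant) =
        proj₂ (proj₂ (proj₂ (hub-spec (proj₂ (U-spec Up)))) top (◂par (Top⇒≢root top)) t≢hub pendant)

      Lost⇒claimant◂ : ∀ {t} → Lost t → Pendant t → claimant t ◂ t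
      Lost⇒claimant◂ (top , Up , t≢hub) pendant =
        proj₁ (proj₂ (proj₂ (hub-spec (proj₂ (U-spec Up)))) top (◂par (Top⇒≢root top)) t≢hub pendant)

      hub◂ : ∀ {u} → U u → hub u ◂ u
      hub◂ Uu = proj₁ (hub-spec (proj₂ (U-spec Uu)))

      hub-Top : ∀ {u} → U u → Top (hub u)
      hub-Top Uu = covered-child (hub◂ Uu) (proj₁ (proj₂ (hub-spec (proj₂ (U-spec Uu))))) (proj₁ (U-spec Uu))

      U-cases : ∀ {u} → U u → u ≡ root ⊎ (Lost (par u) × Pendant (par u) × claimant (par u) ≡ u)
      U-cases u-root = inj₁ refl
      U-cases (u-step {t} lost pendant) =
        inj₂ (subst (λ x → Lost x × Pendant x × claimant x ≡ claimant t) (sym (proj₂ (Lost⇒claimant◂ lost pendant)))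
               (lost , pendant , refl))

      private
        U-within : ∀ k u → depth u ≤ k → Dec (U u)
        U-within k u d≤k with u ≟ᶠ root
        U-within k       u d≤k | yes refl = yes u-root
        U-within zero    u d≤k | no u≢root = contradiction (subst (_≤ 0) (depth-par u≢root) d≤k) λ ()
        U-within (suc k) u d≤k | no u≢root with top? (par u)
        ... | no ¬top = no λ Uu → Sum.[ u≢root , (λ (lost , _) → ¬top (proj₁ lost)) ] (U-cases Uu)
        ... | yes top = map′
          (λ (Up , t≢hub , pendant , eq) → subst U eq (u-step (top , Up , t≢hub) pendant))
          (λ Uu → Sum.[ (λ u≡root → contradiction u≡root u≢root)
                      , (λ ((_ , Up , t≢hub) , pendant , eq) → Up , t≢hub , pendant , eq) ] (U-cases Uu))
          (U-within k (par (par u)) pp≤k ×-dec ¬? (par u ≟ᶠ hub (par (par u))) ×-dec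
           pendant? (par u) ×-dec (claimant (par u) ≟ᶠ u))
          where
          pp≤k : depth (par (par u)) ≤ k
          -- `U` looks two levels up while `k` drops by one, so one level is to spare.
          pp≤k = ℕₚ.≤-pred (ℕₚ.≤-trans (ℕₚ.n≤1+n _)
            (subst (_≤ suc k) (trans (depth-par u≢root) (cong suc (depth-par (Top⇒≢root top)))) d≤k))

      U? : Decidable U
      U? u = U-within (depth u) u ℕₚ.≤-refl

      lost? : Decidable Lost
      lost? t = top? t ×-dec U? (par t) ×-dec ¬? (t ≟ᶠ hub (par t))

      -- The relays: centers of the stars that make up for lost edges whose bottom has a child.
      W : Fin n → Set
      W w = w ≢ root × Bottom (par w) × Lost (par (par w)) × relay (par w) ≡ w

      W? : Decidable W
      W? w = ¬? (w ≟ᶠ root) ×-dec bottom? (par w) ×-dec lost? (par (par w)) ×-dec (relay (par w) ≟ᶠ w)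

      U-uncovered : ∀ {u} → U u → ¬ Covered u
      U-uncovered Uu = proj₁ (U-spec Uu)

      W-uncovered : ∀ {w} → W w → ¬ Covered w
      W-uncovered (w≢root , bot , _) = child-of-Bottom (◂par w≢root) bot

      U-W-disjoint : ∀ {x} → U x → ¬ W x
      U-W-disjoint Ux (x≢root , bot , _) with U-cases Ux
      ... | inj₁ x≡root = x≢root x≡root
      ... | inj₂ (lost , _) = proj₂ (proj₁ lost) bot

      -- A top below a relay becomes a leaf of the star there, so its bottom is dropped. The bottom
      -- of a lost edge stays only if it has a child, to be a leaf at the relay.
      data X : Fin n → Set where
        x-U      : ∀ {v} → U v → X v
        x-W      : ∀ {v} → W v → X v
        x-top    : ∀ {v} → Top v → ¬ Lost v → X v
        x-bottom : ∀ {v} → Bottom v → ¬ W (par (par v)) → (Lost (par v) → HasChild v) → X v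

      X? : Decidable X
      X? v = map′
        Sum.[ x-U , Sum.[ x-W , Sum.[ (λ (p , q) → x-top p q) , (λ (p , q , r) → x-bottom p q r) ] ] ]
        (λ { (x-U p) → inj₁ p ; (x-W p) → inj₂ (inj₁ p) ; (x-top p q) → inj₂ (inj₂ (inj₁ (p , q)))
           ; (x-bottom p q r) → inj₂ (inj₂ (inj₂ (p , q , r))) })
        (U? v ⊎-dec W? v ⊎-dec (top? v ×-dec ¬? (lost? v)) ⊎-dec
         (bottom? v ×-dec ¬? (W? (par (par v))) ×-dec (lost? (par v) →-dec hasChild? v)))

      data XEdge (x y : Fin n) : Set where
        relay-edge  : W x → Bottom y → Lost (par y) → XEdge x y
        hub-edge    : Top x → U y → x ≡ hub y → XEdge x y
        star-edge   : Top x → W y → XEdge x y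
        kept-edge   : Bottom x → Top y → ¬ W (par y) → ¬ Lost y → XEdge x y

      classify : ∀ {x y} → X x → X y → x ◂ y → XEdge x y
      classify (x-U Ux) Xy (x≢root , refl) with U-cases Ux
      ... | inj₁ x≡root = contradiction x≡root x≢root
      ... | inj₂ (lost@(top , _) , _) with Xy
      ...   | x-U Uy             = contradiction (proj₁ top) (U-uncovered Uy)
      ...   | x-W Wy             = contradiction (proj₁ top) (W-uncovered Wy)
      ...   | x-top _ ¬lost      = contradiction lost ¬lost
      ...   | x-bottom bot _ _   = contradiction bot (proj₂ top)
      classify (x-W Wx@(_ , bot , lost , _)) _ (_ , refl) = relay-edge Wx bot lost
      classify {x} (x-top top ¬lost) (x-U Uy) (_ , refl) with x ≟ᶠ hub (par x)
      ... | yes x≡hub = hub-edge top Uy x≡hub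
      ... | no x≢hub  = contradiction (top , Uy , x≢hub) ¬lost
      classify (x-top top _) (x-W Wy) _ = star-edge top Wy
      classify (x-top top _) (x-top top′ _) (x≢root , refl) = contradiction (proj₁ top′) (par-of-Top top x≢root)
      classify (x-top top _) (x-bottom bot _ _) (x≢root , refl) =
        contradiction (Bottom⇒Covered bot) (par-of-Top top x≢root)
      classify (x-bottom bot _ _) (x-U Uy) (_ , refl) =
        contradiction (proj₁ (Bottom⇒Top-par bot)) (U-uncovered Uy)
      classify (x-bottom bot _ _) (x-W Wy) (_ , refl) =
        contradiction (proj₁ (Bottom⇒Top-par bot)) (W-uncovered Wy)
      classify (x-bottom bot ¬W _) (x-top top ¬lost) (_ , refl) = kept-edge bot top ¬W ¬lost
      classify (x-bottom bot _ _) (x-bottom bot′ _ _) (_ , refl) = contradiction bot′ (proj₂ (Bottom⇒Top-par bot))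

      neighbour : ∀ {v w} → X v → X w → w ∼ v → (w ◂ v × XEdge w v) ⊎ (v ◂ w × XEdge v w)
      neighbour Xv Xw w∼v with adj-par w∼v
      ... | inj₁ w◂v = inj₁ (w◂v , classify Xw Xv w◂v)
      ... | inj₂ v◂w = inj₂ (v◂w , classify Xv Xw v◂w)

      -- The leaf of the star is the bottom on a relay or kept edge, the center in `U` on a hub
      -- edge, and the top on a star edge.
      star : ∀ {x y} → X x → X y → x ◂ y → (∀ {w} → X w → w ∼ x → w ≡ y) ⊎ (∀ {w} → X w → w ∼ y → w ≡ x)
      star {x} {y} Xx Xy x◂y with classify Xx Xy x◂y
      ... | relay-edge Wx bot lost = inj₂ λ Xw w∼y → only (neighbour Xy Xw w∼y)
        where
        only : ∀ {w} → (w ◂ y × XEdge w y) ⊎ (y ◂ w × XEdge y w) → w ≡ x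
        only (inj₁ (w◂y , relay-edge Ww _ _)) = begin
          _                    ≡⟨ sym (proj₂ (proj₂ (proj₂ Ww))) ⟩
          relay (par _)        ≡⟨ cong relay (trans (proj₂ w◂y) (sym (proj₂ x◂y))) ⟩
          relay (par x)        ≡⟨ proj₂ (proj₂ (proj₂ Wx)) ⟩
          x                    ∎
          where open ≡-Reasoning
        only (inj₁ (_ , hub-edge _ Uy _))       = contradiction (Bottom⇒Covered bot) (U-uncovered Uy)
        only (inj₁ (_ , star-edge _ Wy))        = contradiction (Bottom⇒Covered bot) (W-uncovered Wy)
        only (inj₁ (_ , kept-edge _ top _ _))   = contradiction bot (proj₂ top)
        only (inj₂ (_ , relay-edge Wy _ _))     = contradiction (Bottom⇒Covered bot) (W-uncovered Wy)
        only (inj₂ (_ , hub-edge top _ _))      = contradiction bot (proj₂ top)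
        only (inj₂ (_ , star-edge top _))       = contradiction bot (proj₂ top)
        only (inj₂ ((_ , refl) , kept-edge _ _ _ ¬lost)) = contradiction lost ¬lost
      ... | hub-edge _ Uy x≡hub = inj₂ λ Xw w∼y → only (neighbour Xy Xw w∼y)
        where
        only : ∀ {w} → (w ◂ y × XEdge w y) ⊎ (y ◂ w × XEdge y w) → w ≡ x
        only (inj₁ (_ , relay-edge _ bot _))    = contradiction (Bottom⇒Covered bot) (U-uncovered Uy)
        only (inj₁ (_ , hub-edge _ _ w≡hub))    = trans w≡hub (sym x≡hub)
        only (inj₁ (_ , star-edge _ Wy))        = contradiction Wy (U-W-disjoint Uy)
        only (inj₁ (_ , kept-edge _ top _ _))   = contradiction (proj₁ top) (U-uncovered Uy)
        only (inj₂ (_ , relay-edge Wy _ _))     = contradiction Wy (U-W-disjoint Uy)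
        only (inj₂ (_ , hub-edge top _ _))      = contradiction (proj₁ top) (U-uncovered Uy)
        only (inj₂ (_ , star-edge top _))       = contradiction (proj₁ top) (U-uncovered Uy)
        only (inj₂ (_ , kept-edge bot _ _ _))   = contradiction (Bottom⇒Covered bot) (U-uncovered Uy)
      ... | star-edge topx Wy = inj₁ λ Xw w∼x → only (neighbour Xx Xw w∼x)
        where
        only : ∀ {w} → (w ◂ x × XEdge w x) ⊎ (x ◂ w × XEdge x w) → w ≡ y
        only (inj₁ (_ , relay-edge _ bot _))    = contradiction bot (proj₂ topx)
        only (inj₁ (_ , hub-edge _ Ux _))       = contradiction (proj₁ topx) (U-uncovered Ux)
        only (inj₁ (_ , star-edge _ Wx))        = contradiction (proj₁ topx) (W-uncovered Wx)
        only (inj₁ (_ , kept-edge _ _ ¬W _))    = contradiction (subst W (sym (proj₂ x◂y)) Wy) ¬W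
        only (inj₂ (x◂w , _))                   = ◂-functional x◂w x◂y
      ... | kept-edge botx _ _ ¬lost = inj₁ λ Xw w∼x → only (neighbour Xx Xw w∼x)
        where
        only : ∀ {w} → (w ◂ x × XEdge w x) ⊎ (x ◂ w × XEdge x w) → w ≡ y
        only (inj₁ (_ , relay-edge _ _ lost))   = contradiction (subst Lost (proj₂ x◂y) lost) ¬lost
        only (inj₁ (_ , hub-edge _ Ux _))       = contradiction (Bottom⇒Covered botx) (U-uncovered Ux)
        only (inj₁ (_ , star-edge _ Wx))        = contradiction (Bottom⇒Covered botx) (W-uncovered Wx)
        only (inj₁ (_ , kept-edge _ top _ _))   = contradiction botx (proj₂ top)
        only (inj₂ (x◂w , _))                   = ◂-functional x◂w x◂y

      -- The kinds of `y` and `par y` separate the constructors. In `by-hub` the claimant is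
      -- `par y`, so `par (par y)` is the top of the lost edge; as the root is excluded, its hub
      -- edge replaces nothing and is the gain.
      data Replaces (b y : Fin n) : Set where
        by-itself : Bottom y → y ≡ b → Replaces b y
        by-relay  : ¬ Covered y → par y ≡ b → Replaces b y
        by-star   : Top y → W (par y) → mate y ≡ b → Replaces b y
        by-hub    : Top y → U (par y) → par y ≢ root → mate (par (par y)) ≡ b → Replaces b y

      Replaces-injective : ∀ {b b′ y} → Replaces b y → Replaces b′ y → b ≡ b′
      Replaces-injective (by-itself _ p)     (by-itself _ q)     = trans (sym p) q
      Replaces-injective (by-relay _ p)      (by-relay _ q)      = trans (sym p) q
      Replaces-injective (by-star _ _ p)     (by-star _ _ q)     = trans (sym p) q
      Replaces-injective (by-hub _ _ _ p)    (by-hub _ _ _ q)    = trans (sym p) q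
      Replaces-injective (by-itself bot _)   (by-relay ¬cov _)   = contradiction (Bottom⇒Covered bot) ¬cov
      Replaces-injective (by-relay ¬cov _)   (by-itself bot _)   = contradiction (Bottom⇒Covered bot) ¬cov
      Replaces-injective (by-itself bot _)   (by-star top _ _)   = contradiction bot (proj₂ top)
      Replaces-injective (by-star top _ _)   (by-itself bot _)   = contradiction bot (proj₂ top)
      Replaces-injective (by-itself bot _)   (by-hub top _ _ _)  = contradiction bot (proj₂ top)
      Replaces-injective (by-hub top _ _ _)  (by-itself bot _)   = contradiction bot (proj₂ top)
      Replaces-injective (by-relay ¬cov _)   (by-star top _ _)   = contradiction (proj₁ top) ¬cov
      Replaces-injective (by-star top _ _)   (by-relay ¬cov _)   = contradiction (proj₁ top) ¬cov
      Replaces-injective (by-relay ¬cov _)   (by-hub top _ _ _)  = contradiction (proj₁ top) ¬cov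
      Replaces-injective (by-hub top _ _ _)  (by-relay ¬cov _)   = contradiction (proj₁ top) ¬cov
      Replaces-injective (by-star _ Wp _)    (by-hub _ Up _ _)   = contradiction Wp (U-W-disjoint Up)
      Replaces-injective (by-hub _ Up _ _)   (by-star _ Wp _)    = contradiction Wp (U-W-disjoint Up)

      hub-not-Lost : ∀ {u} → U u → ¬ Lost (hub u)
      hub-not-Lost Uu (_ , _ , h≢hub) = h≢hub (cong hub (sym (proj₂ (hub◂ Uu))))

      U-par-hub : ∀ {u} → U u → U (par (hub u))
      U-par-hub Uu = subst U (sym (proj₂ (hub◂ Uu))) Uu

      replacement : ∀ {b} → Bottom b → ∃[ y ] (y ≢ root × X y × X (par y) × Replaces b y)
      replacement {b} bot with lost? (par b) | hasChild? b
      ... | yes lost | yes child = relay b , proj₁ w◂b , x-W Ww ,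
              subst X (sym (proj₂ w◂b)) (x-bottom bot (U-W-disjoint (proj₁ (proj₂ lost))) (λ _ → child)) ,
              by-relay (W-uncovered Ww) (proj₂ w◂b)
        where
        w◂b : relay b ◂ b
        w◂b = choose-satisfies (λ v → v ◂? b) b child

        Ww : W (relay b)
        Ww = proj₁ w◂b , subst (λ v → Bottom v × Lost (par v) × relay v ≡ relay b) (sym (proj₂ w◂b))
               (bot , lost , refl)
      -- A lost edge without a child below is pendant; the hub edge of its claimant takes its place.
      ... | yes lost | no childless = hub u , proj₁ (hub◂ Uu) , x-top (hub-Top Uu) (hub-not-Lost Uu) ,
              x-U (U-par-hub Uu) ,
              by-hub (hub-Top Uu) (U-par-hub Uu) (subst (_≢ root) (sym (proj₂ (hub◂ Uu))) (proj₁ u◂t))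
                (trans (cong mate (trans (cong par (proj₂ (hub◂ Uu))) (proj₂ u◂t))) (mate-par-Bottom bot))
        where
        u = claimant (par b)

        pendant : Pendant (par b)
        pendant = childless⇒pendant (proj₁ lost) (subst (¬_ ∘ HasChild) (sym (mate-par-Bottom bot)) childless)

        u◂t : u ◂ par b
        u◂t = Lost⇒claimant◂ lost pendant

        Uu : U u
        Uu = u-step lost pendant
      ... | no ¬lost | _ with W? (par (par b))
      ...   | yes Wp = par b , Top⇒≢root (Bottom⇒Top-par bot) , x-top (Bottom⇒Top-par bot) ¬lost , x-W Wp ,
                by-star (Bottom⇒Top-par bot) Wp (mate-par-Bottom bot)
      ...   | no ¬Wp = b , Bottom⇒≢root bot , x-bottom bot ¬Wp (λ lost → contradiction lost ¬lost) ,
                x-top (Bottom⇒Top-par bot) ¬lost , by-itself bot refl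

      absurd : ⊥
      absurd = no-larger-star-forest X X? star Replaces replacement Replaces-injective
        {hub root} (proj₁ (hub◂ u-root)) (x-top (hub-Top u-root) (hub-not-Lost u-root)) (x-U (U-par-hub u-root)) λ where
          (by-itself bot _)        → proj₂ (hub-Top u-root) bot
          (by-relay ¬cov _)        → ¬cov (proj₁ (hub-Top u-root))
          (by-star _ Wp _)         → U-W-disjoint (U-par-hub u-root) Wp
          (by-hub _ _ p≢root _)    → p≢root (proj₂ (hub◂ u-root))

    root-not-needy : ¬ Needy (par root) root
    root-not-needy = Swap.absurd

    -- If no neighbour of the root is covered, then the edge from the root to its
    -- child z is gained, the matching edges next to z being traded for a star at z.
    module Isolated (no-covered : ∀ {v} → v ∼ root → ¬ Covered v) {z : Fin n} (z◂root : z ◂ root) where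

      z-uncovered : ¬ Covered z
      z-uncovered = no-covered (◂⇒∼ z◂root)

      data X : Fin n → Set where
        x-root   : X root
        x-z      : X z
        x-top    : ∀ {v} → Top v → X v
        x-bottom : ∀ {v} → Bottom v → par (par v) ≢ z → X v

      X? : Decidable X
      X? v = map′
        Sum.[ (λ { refl → x-root }) , Sum.[ (λ { refl → x-z }) , Sum.[ x-top , (λ (p , q) → x-bottom p q) ] ] ]
        (λ { x-root → inj₁ refl ; x-z → inj₂ (inj₁ refl) ; (x-top p) → inj₂ (inj₂ (inj₁ p))
           ; (x-bottom p q) → inj₂ (inj₂ (inj₂ (p , q))) })
        ((v ≟ᶠ root) ⊎-dec (v ≟ᶠ z) ⊎-dec top? v ⊎-dec (bottom? v ×-dec ¬? (par (par v) ≟ᶠ z)))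

      data XEdge : Fin n → Fin n → Set where
        new-edge  : XEdge z root
        star-edge : ∀ {x} → Top x → par x ≡ z → XEdge x z
        kept-edge : ∀ {x y} → Bottom x → Top y → par y ≢ z → XEdge x y

      classify : ∀ {x y} → X x → X y → x ◂ y → XEdge x y
      classify x-root _ (r≢r , _) = contradiction refl r≢r
      classify x-z _ z◂y with refl ← ◂-functional z◂y z◂root = new-edge
      classify (x-top top) x-root x◂r = contradiction (proj₁ top) (no-covered (◂⇒∼ x◂r))
      classify (x-top top) x-z x◂z = star-edge top (proj₂ x◂z)
      classify (x-top top) (x-top top′) (x≢root , refl) = contradiction (proj₁ top′) (par-of-Top top x≢root)
      classify (x-top top) (x-bottom bot _) (x≢root , refl) =
        contradiction (Bottom⇒Covered bot) (par-of-Top top x≢root)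
      classify (x-bottom bot pp≢z) _ (_ , refl) = kept-edge bot (Bottom⇒Top-par bot) pp≢z

      neighbour : ∀ {v w} → X v → X w → w ∼ v → (w ◂ v × XEdge w v) ⊎ (v ◂ w × XEdge v w)
      neighbour Xv Xw w∼v with adj-par w∼v
      ... | inj₁ w◂v = inj₁ (w◂v , classify Xw Xv w◂v)
      ... | inj₂ v◂w = inj₂ (v◂w , classify Xv Xw v◂w)

      star : ∀ {x y} → X x → X y → x ◂ y → (∀ {w} → X w → w ∼ x → w ≡ y) ⊎ (∀ {w} → X w → w ∼ y → w ≡ x)
      star {x} {y} Xx Xy x◂y = from-kind (classify Xx Xy x◂y) Xx Xy x◂y
        where
        from-kind : ∀ {x y} → XEdge x y → X x → X y → x ◂ y →
                    (∀ {w} → X w → w ∼ x → w ≡ y) ⊎ (∀ {w} → X w → w ∼ y → w ≡ x)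
        from-kind new-edge _ Xr _ = inj₂ λ Xw w∼r → only (neighbour Xr Xw w∼r)
          where
          only : ∀ {w} → (w ◂ root × XEdge w root) ⊎ (root ◂ w × XEdge root w) → w ≡ z
          only (inj₂ ((r≢r , _) , _))             = contradiction refl r≢r
          only (inj₁ (w◂r , e))                   = only′ e refl w◂r
            where
            -- The index `root` is generalised to `r`, because `z` and `root` cannot be unified when
            -- `XEdge` is matched.
            only′ : ∀ {w r} → XEdge w r → r ≡ root → w ◂ r → w ≡ z
            only′ new-edge _ _ = refl
            only′ (star-edge top _) refl w◂r = contradiction (proj₁ top) (no-covered (◂⇒∼ w◂r))
            only′ (kept-edge bot _ _) refl w◂r = contradiction (Bottom⇒Covered bot) (no-covered (◂⇒∼ w◂r))
        from-kind {x} {y} (star-edge top px≡z) Xx _ x◂y = inj₁ λ Xw w∼x → only (neighbour Xx Xw w∼x)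
          where
          only : ∀ {w} → (w ◂ x × XEdge w x) ⊎ (x ◂ w × XEdge x w) → w ≡ y
          only (inj₂ (x◂w , _))                   = ◂-functional x◂w x◂y
          only (inj₁ (_ , new-edge))              = contradiction (proj₁ top) root-uncovered
          only (inj₁ (_ , star-edge _ _))         = contradiction (proj₁ top) z-uncovered
          only (inj₁ (_ , kept-edge _ _ px≢z))    = contradiction px≡z px≢z
        from-kind {x} {y} (kept-edge bot _ _) Xx _ x◂y = inj₁ λ Xw w∼x → only (neighbour Xx Xw w∼x)
          where
          only : ∀ {w} → (w ◂ x × XEdge w x) ⊎ (x ◂ w × XEdge x w) → w ≡ y
          only (inj₂ (x◂w , _))                   = ◂-functional x◂w x◂y
          only (inj₁ (_ , new-edge))              = contradiction (Bottom⇒Covered bot) root-uncovered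
          only (inj₁ (_ , star-edge _ _))         = contradiction (Bottom⇒Covered bot) z-uncovered
          only (inj₁ (_ , kept-edge _ top _))     = contradiction bot (proj₂ top)

      data Replaces (b y : Fin n) : Set where
        by-itself : Bottom y → y ≡ b → Replaces b y
        by-star   : Top y → mate y ≡ b → Replaces b y

      Replaces-injective : ∀ {b b′ y} → Replaces b y → Replaces b′ y → b ≡ b′
      Replaces-injective (by-itself _ p)   (by-itself _ q)   = trans (sym p) q
      Replaces-injective (by-star _ p)     (by-star _ q)     = trans (sym p) q
      Replaces-injective (by-itself bot _) (by-star top _)   = contradiction bot (proj₂ top)
      Replaces-injective (by-star top _)   (by-itself bot _) = contradiction bot (proj₂ top)

      replacement : ∀ {b} → Bottom b → ∃[ y ] (y ≢ root × X y × X (par y) × Replaces b y)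
      replacement {b} bot with par (par b) ≟ᶠ z
      ... | yes pp≡z = par b , Top⇒≢root top , x-top top , subst X (sym pp≡z) x-z , by-star top (mate-par-Bottom bot)
        where top = Bottom⇒Top-par bot
      ... | no pp≢z = b , Bottom⇒≢root bot , x-bottom bot pp≢z , x-top (Bottom⇒Top-par bot) , by-itself bot refl

      absurd : ⊥
      absurd = no-larger-star-forest X X? star Replaces replacement Replaces-injective
        (proj₁ z◂root) x-z (subst X (sym (proj₂ z◂root)) x-root) λ where
          (by-itself bot _) → z-uncovered (Bottom⇒Covered bot)
          (by-star top _)   → z-uncovered (proj₁ top)

-- Trees covered by spiders

≅-from-bijection : {V W : Set} {G : Graph V} {H : Graph W} (f : W → V) → (∀ {p q} → f p ≡ f q → p ≡ q) →
                   (∀ v → ∃[ w ] f w ≡ v) → (∀ p q → Adj H p q ⇔ Adj G (f p) (f q)) → G ≅ H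
≅-from-bijection {G = G} {H} f injective surjective adj = record
  { vertices = mk↔ₛ′ f⁻¹ f (λ p → injective (f-f⁻¹ (f p))) f-f⁻¹
  ; adj⇔ = λ x y → mk⇔
      (λ x∼y → Equivalence.from (adj _ _) (subst₂ (Adj G) (sym (f-f⁻¹ x)) (sym (f-f⁻¹ y)) x∼y))
      (λ p∼q → subst₂ (Adj G) (f-f⁻¹ x) (f-f⁻¹ y) (Equivalence.to (adj _ _) p∼q))
  }
  where
  f⁻¹ = λ v → proj₁ (surjective v)

  f-f⁻¹ : ∀ v → f (f⁻¹ v) ≡ v
  f-f⁻¹ v = proj₂ (surjective v)

≅-IsTree : {V W : Set} {G : Graph V} {H : Graph W} → G ≅ H → IsTree G → IsTree H
≅-IsTree {V} {W} {G} {H} G≅H isTree = record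
  { nonempty  = to nonempty
  ; connected = λ p q → subst₂ (Star (Adj H)) (strictlyInverseˡ p) (strictlyInverseˡ q)
                          (Star.gmap to (≅-to-adj G≅H) (connected (from p) (from q)))
  ; acyclic   = λ p ps (2≤ , unique , linked) → acyclic (from p) (map from ps)
      ( subst (2 ≤_) (sym (Listₚ.length-map from ps)) 2≤
      , Uniqueₚ.map⁺ (≅-from-injective G≅H) unique
      , subst (Linked.Linked (Adj G)) (cong (from p ∷_) (Listₚ.map-++ from ps [ p ]))
          (Linkedₚ.map⁺ (Linked.map (≅-from-adj G≅H) linked)))
  }
  where
  open IsTree isTree
  open Inverse (_≅_.vertices G≅H) using (to; from; strictlyInverseˡ)

record Enumeration (P : Pred (Fin n) 0ℓ) : Set where
  field
    size       : ℕ
    at         : Fin size → Fin n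
    holds      : ∀ i → P (at i)
    injective  : ∀ {i j} → at i ≡ at j → i ≡ j
    index      : ∀ {x} → P x → ∃[ i ] at i ≡ x

enumerate : {P : Pred (Fin n) 0ℓ} → Decidable P → Enumeration P
enumerate P? = record
  { size      = ∣ ⟦ P? ⟧ ∣
  ; at        = nth ⟦ P? ⟧
  ; holds     = λ i → ∈⟦⟧⁻ P? (nth-∈ ⟦ P? ⟧ i)
  ; injective = nth-injective ⟦ P? ⟧
  ; index     = λ Px → nth-surjective ⟦ P? ⟧ (∈⟦⟧⁺ P? Px)
  }

foot-injective : ∀ {k} {i j : Fin k} → foot i ≡ foot j → i ≡ j
foot-injective refl = refl

≢⇒2≤ : {i j : Fin n} → i ≢ j → 2 ≤ n
≢⇒2≤ {suc zero}    {zero} {zero} i≢j = contradiction refl i≢j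
≢⇒2≤ {suc (suc _)} _ = s≤s (s≤s z≤n)

-- A partition of a rooted tree into spiders: the middle and the foot of a leg
-- are a top and its mate, and owner sends a top to the center of its spider.
record SpiderCover {G : Graph (Fin n)} {root : Fin n} (rooted : Rooted G root) : Set₁ where
  open Edges G
  open RootedTree rooted
  field
    Center Top Bottom : Fin n → Set
    center?           : Decidable Center
    top?              : Decidable Top
    kind              : ∀ x → Center x ⊎ Top x ⊎ Bottom x
    center≢top        : ∀ {x} → Center x → ¬ Top x
    center≢bottom     : ∀ {x} → Center x → ¬ Bottom x
    top≢bottom        : ∀ {x} → Top x → ¬ Bottom x
    root-center       : Center root
    mate owner        : Fin n → Fin n
    mate-bottom       : ∀ {t} → Top t → Bottom (mate t)
    par-mate          : ∀ {t} → Top t → par (mate t) ≡ t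
    mate-par          : ∀ {b} → Bottom b → mate (par b) ≡ b
    par-top           : ∀ {b} → Bottom b → Top (par b)
    par-center        : ∀ {t} → Top t → Center (par t)
    owner-center      : ∀ {t} → Top t → Center (owner t)
    owner-adjacent    : ∀ {t} → Top t → owner t ∼ t

  Pendant : Fin n → Set
  Pendant t = ∀ v → v ∼ mate t → v ≡ t

  PendantLeg : Fin n → Fin n → Set
  PendantLeg u t = Top t × owner t ≡ u × Pendant t

  field
    two-pendant-legs : ∀ {u} → Center u → ∃[ t ] ∃[ t′ ] (t ≢ t′ × PendantLeg u t × PendantLeg u t′)

module SpiderCover⇒𝓕 {G : Graph (Fin n)} (isTree : IsTree G) {root : Fin n} {rooted : Rooted G root}
                     (cover : SpiderCover rooted) where
  open Edges G
  open RootedTree rooted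
  open SpiderCover cover

  top≢root : ∀ {t} → Top t → t ≢ root
  top≢root top refl = center≢top root-center top

  bottom≢root : ∀ {b} → Bottom b → b ≢ root
  bottom≢root bot refl = center≢bottom root-center bot

  -- The spider edges, directed from the outer to the inner vertex.
  data Link (x y : Fin n) : Set where
    to-owner : Top x → owner x ≡ y → Link x y
    to-mate  : Bottom x → par x ≡ y → Link x y

  Link⇒∼ : ∀ {x y} → Link x y → x ∼ y
  Link⇒∼ (to-owner top refl) = ∼-sym (owner-adjacent top)
  Link⇒∼ (to-mate bot refl)  = par-adj (bottom≢root bot)

  center-not-linked : ∀ {x y} → Center x → ¬ Link x y
  center-not-linked cx (to-owner top _) = center≢top cx top
  center-not-linked cx (to-mate bot _)  = center≢bottom cx bot

  -- The vertex nearest to the root of the spider with center u.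
  crest : Fin n → Fin n
  crest u with top? (par u) ×-dec (owner (par u) ≟ᶠ u)
  ... | yes _ = par u
  ... | no _  = u

  data Crest (u : Fin n) : Fin n → Set where
    at-middle : Top (par u) → owner (par u) ≡ u → Crest u (par u)
    at-center : ¬ (Top (par u) × owner (par u) ≡ u) → Crest u u

  crest-view : ∀ u → Crest u (crest u)
  crest-view u with top? (par u) ×-dec (owner (par u) ≟ᶠ u)
  ... | yes (top , eq) = at-middle top eq
  ... | no ¬middle     = at-center ¬middle

  Crest-functional : ∀ {u x y} → Crest u x → Crest u y → x ≡ y
  Crest-functional (at-middle _ _)     (at-middle _ _)     = refl
  Crest-functional (at-middle top eq)  (at-center ¬middle) = contradiction (top , eq) ¬middle
  Crest-functional (at-center ¬middle) (at-middle top eq)  = contradiction (top , eq) ¬middle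
  Crest-functional (at-center _)       (at-center _)       = refl

  Crest-injective : ∀ {u v x} → Center u → Center v → Crest u x → Crest v x → u ≡ v
  Crest-injective {u} {v} cu cv c c′ = same c c′ refl
    where
    same : ∀ {x y} → Crest u x → Crest v y → x ≡ y → u ≡ v
    same (at-middle _ eq)  (at-middle _ eq′) p = trans (sym eq) (trans (cong owner p) eq′)
    same (at-middle top _) (at-center _)     p = contradiction (subst Top p top) (center≢top cv)
    same (at-center _)     (at-middle top _) p = contradiction (subst Top (sym p) top) (center≢top cu)
    same (at-center _)     (at-center _)     p = p

  Crest≢root : ∀ {u x} → u ≢ root → Crest u x → x ≢ root
  Crest≢root _      (at-middle top _) = top≢root top
  Crest≢root u≢root (at-center _)     = u≢root

  Crest-not-linked : ∀ {u x} → Center u → u ≢ root → Crest u x → ¬ Link x (par x) × ¬ Link (par x) x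
  Crest-not-linked {u} cu u≢root (at-middle top eq) =
    (λ where
      (to-owner _ eq′) → ◂-asym (◂par u≢root) (top≢root top , trans (sym eq′) eq)
      (to-mate bot _)  → top≢bottom top bot) ,
    center-not-linked (par-center top)
  Crest-not-linked cu u≢root (at-center ¬middle) =
    center-not-linked cu ,
    (λ where
      (to-owner top eq) → ¬middle (top , eq)
      (to-mate bot eq)  → ◂-asym (◂par u≢root) (bottom≢root bot , eq))

  -- The source of C1: a crest that is a middle has a center of another spider as its parent.
  Crest-center : ∀ {u x} → Center u → Crest u x → Center x ⊎ Center (par x)
  Crest-center cu (at-middle top _) = inj₂ (par-center top)
  Crest-center cu (at-center _)     = inj₁ cu

  data EdgeKind (x y : Fin n) : Set where
    linked   : Link x y → EdgeKind x y
    linked⁻¹ : Link y x → EdgeKind x y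
    crested  : ∀ u → Center u → u ≢ root → Crest u x → EdgeKind x y

  -- An edge outside the spiders lies above the crest of a spider whose center is not the root. One
  -- edge for each of these spiders gives exactly the required number of added edges.
  edgeKind : ∀ {x y} → x ◂ y → EdgeKind x y
  edgeKind {x} x◂y@(x≢root , refl) with kind x
  ... | inj₂ (inj₂ bot) = linked (to-mate bot refl)
  ... | inj₁ cx with top? (par x) ×-dec (owner (par x) ≟ᶠ x)
  ...   | yes (top , eq) = linked⁻¹ (to-owner top eq)
  ...   | no ¬middle = crested x cx x≢root (at-center ¬middle)
  edgeKind {x} x◂y@(x≢root , refl) | inj₂ (inj₁ top) with adj-par (owner-adjacent top)
  ... | inj₁ (o≢root , po≡x) = crested (owner x) (owner-center top) o≢root
          (subst (Crest (owner x)) po≡x (at-middle (subst Top (sym po≡x) top) (cong owner po≡x)))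
  ... | inj₂ (_ , px≡o) = linked (to-owner top (sym px≡o))

  centers : Enumeration Center
  centers = enumerate center?

  legs : ∀ u → Enumeration (λ t → Top t × owner t ≡ u)
  legs u = enumerate (λ t → top? t ×-dec (owner t ≟ᶠ u))

  module Assembly {r} (ctr : Fin (suc r) → Fin n) (ctr-center : ∀ i → Center (ctr i))
                  (ctr-injective : ∀ {i j} → ctr i ≡ ctr j → i ≡ j)
                  (ctr-index : ∀ {x} → Center x → ∃[ i ] ctr i ≡ x) where
    private module Legs i = Enumeration (legs (ctr i))

    k : Fin (suc r) → ℕ
    k i = Legs.size i

    leg : ∀ i → Fin (k i) → Fin n
    leg i j = Legs.at i j

    leg-top : ∀ i j → Top (leg i j)
    leg-top i j = proj₁ (Legs.holds i j)

    leg-owner : ∀ i j → owner (leg i j) ≡ ctr i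
    leg-owner i j = proj₂ (Legs.holds i j)

    place : SpidersVertex k → Fin n
    place (i , center)   = ctr i
    place (i , middle j) = leg i j
    place (i , foot j)   = mate (leg i j)

    leg-injective : ∀ {i j i′ j′} → leg i j ≡ leg i′ j′ → (i , j) ≡ (i′ , j′)
    leg-injective {i} {j} {i′} {j′} eq
      with refl ← ctr-injective (trans (sym (leg-owner i j)) (trans (cong owner eq) (leg-owner i′ j′)))
      with refl ← Legs.injective i eq = refl

    foot-bottom : ∀ i j → Bottom (mate (leg i j))
    foot-bottom i j = mate-bottom (leg-top i j)

    place-injective : ∀ {p q} → place p ≡ place q → p ≡ q
    place-injective {i , center}   {i′ , center}    eq = cong (_, center) (ctr-injective eq)
    place-injective {i , center}   {i′ , middle j′} eq =
      contradiction (subst Top (sym eq) (leg-top i′ j′)) (center≢top (ctr-center i))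
    place-injective {i , center}   {i′ , foot j′}   eq =
      contradiction (subst Bottom (sym eq) (foot-bottom i′ j′)) (center≢bottom (ctr-center i))
    place-injective {i , middle j} {i′ , center}    eq =
      contradiction (subst Top eq (leg-top i j)) (center≢top (ctr-center i′))
    place-injective {i , middle j} {i′ , middle j′} eq with refl ← leg-injective {i} {j} {i′} {j′} eq = refl
    place-injective {i , middle j} {i′ , foot j′}   eq =
      contradiction (subst Bottom (sym eq) (foot-bottom i′ j′)) (top≢bottom (leg-top i j))
    place-injective {i , foot j}   {i′ , center}    eq =
      contradiction (subst Bottom eq (foot-bottom i j)) (center≢bottom (ctr-center i′))
    place-injective {i , foot j}   {i′ , middle j′} eq =
      contradiction (subst Bottom eq (foot-bottom i j)) (top≢bottom (leg-top i′ j′))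
    place-injective {i , foot j}   {i′ , foot j′}   eq
      with refl ← leg-injective {i} {j} {i′} {j′}
        (trans (sym (par-mate (leg-top i j))) (trans (cong par eq) (par-mate (leg-top i′ j′)))) = refl

    leg-index : ∀ {t} → Top t → ∃[ i ] ∃[ j ] leg i j ≡ t
    leg-index {t} top = let i , eq = ctr-index (owner-center top)
                            j , eq′ = Legs.index i (top , sym eq)
                        in i , j , eq′

    place-surjective : ∀ x → ∃[ p ] place p ≡ x
    place-surjective x with kind x
    ... | inj₁ cx = let i , eq = ctr-index cx in (i , center) , eq
    ... | inj₂ (inj₁ top) = let i , j , eq = leg-index top in (i , middle j) , eq
    ... | inj₂ (inj₂ bot) =
      let i , j , eq = leg-index (par-top bot)
      in (i , foot j) , trans (cong mate eq) (mate-par bot)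

    unplace : Fin n → SpidersVertex k
    unplace x = proj₁ (place-surjective x)

    place-unplace : ∀ x → place (unplace x) ≡ x
    place-unplace x = proj₂ (place-surjective x)

    unplace-injective : ∀ {x y} → unplace x ≡ unplace y → x ≡ y
    unplace-injective eq = trans (sym (place-unplace _)) (trans (cong place eq) (place-unplace _))

    center⇒IsCenter : ∀ {x} → Center x → IsCenter k (unplace x)
    center⇒IsCenter {x} cx = is-center (unplace x) (place-unplace x)
      where
      is-center : ∀ p → place p ≡ x → IsCenter k p
      is-center (i , center)   _    = i , refl
      is-center (i , middle j) refl = contradiction (leg-top i j) (center≢top cx)
      is-center (i , foot j)   refl = contradiction (foot-bottom i j) (center≢bottom cx)

    spider-edge⇒Link : ∀ {i x y} → SpiderEdge x y → Link (place (i , y)) (place (i , x))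
    spider-edge⇒Link {i} (center-middle j) = to-owner (leg-top i j) (leg-owner i j)
    spider-edge⇒Link {i} (middle-foot j)   = to-mate (foot-bottom i j) (par-mate (leg-top i j))

    spiders⇒Link : ∀ {p q} → Adj (spiders k) p q → Link (place p) (place q) ⊎ Link (place q) (place p)
    spiders⇒Link (inPart (fwd e)) = inj₂ (spider-edge⇒Link e)
    spiders⇒Link (inPart (bwd e)) = inj₁ (spider-edge⇒Link e)

    Link⇒spiders : ∀ {p q} → Link (place p) (place q) → Adj (spiders k) p q
    Link⇒spiders {i , center}   (to-owner top _) = contradiction top (center≢top (ctr-center i))
    Link⇒spiders {i , center}   (to-mate bot _)  = contradiction bot (center≢bottom (ctr-center i))
    Link⇒spiders {i , middle j} {q} (to-owner _ eq)
      with refl ← place-injective {i , center} {q} (trans (sym (leg-owner i j)) eq) = inPart (bwd (center-middle j))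
    Link⇒spiders {i , middle j} (to-mate bot _)  = contradiction bot (top≢bottom (leg-top i j))
    Link⇒spiders {i , foot j}   (to-owner top _) = contradiction (foot-bottom i j) (top≢bottom top)
    Link⇒spiders {i , foot j}   {q} (to-mate _ eq)
      with refl ← place-injective {i , middle j} {q} (trans (sym (par-mate (leg-top i j))) eq) = inPart (bwd (middle-foot j))

    home : Fin (suc r)
    home = proj₁ (ctr-index root-center)

    -- The spider of the root has no edge above it; skipping it leaves one center for each of the
    -- `r` added edges.
    away : Fin r → Fin n
    away e = ctr (punchIn home e)

    away≢root : ∀ e → away e ≢ root
    away≢root e eq = punchInᵢ≢i home e (ctr-injective (trans eq (sym (proj₂ (ctr-index root-center)))))

    away-index : ∀ {u} → Center u → u ≢ root → ∃[ e ] away e ≡ u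
    away-index {u} cu u≢root = punchOut home≢i ,
      trans (cong ctr (punchIn-punchOut home≢i)) (proj₂ (ctr-index cu))
      where
      home≢i : home ≢ proj₁ (ctr-index cu)
      home≢i eq = u≢root (trans (sym (proj₂ (ctr-index cu)))
                    (trans (cong ctr (sym eq)) (proj₂ (ctr-index root-center))))

    lower : Fin r → Fin n
    lower e = crest (away e)

    lower-crest : ∀ e → Crest (away e) (lower e)
    lower-crest e = crest-view (away e)

    lower≢root : ∀ e → lower e ≢ root
    lower≢root e = Crest≢root (away≢root e) (lower-crest e)

    lower-injective : ∀ {e f} → lower e ≡ lower f → e ≡ f
    lower-injective {e} {f} eq = punchIn-injective home e f (ctr-injective
      (Crest-injective (ctr-center _) (ctr-center _) (lower-crest e)
        (subst (Crest (away f)) (sym eq) (lower-crest f))))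

    newEdges : NewEdges (spiders k) r
    newEdges = record
      { ends     = λ e → unplace (lower e) , unplace (par (lower e))
      ; loopless = λ e eq → ∼⇒≢ (par-adj (lower≢root e)) (unplace-injective eq)
      ; new      = λ e adj → not-linked e (subst₂ (λ x y → Link x y ⊎ Link y x)
                     (place-unplace _) (place-unplace _) (spiders⇒Link adj))
      ; distinct = λ e f e≢f →
          (λ eq → e≢f (lower-injective (unplace-injective (cong proj₁ eq)))) ,
          -- If the ends agreed in swapped order, each lower end would be the parent of the other.
          (λ eq → ◂-asym (lower≢root e , unplace-injective (cong proj₂ eq))
                         (lower≢root f , sym (unplace-injective (cong proj₁ eq))))
      }
      where
      not-linked : ∀ e → ¬ (Link (lower e) (par (lower e)) ⊎ Link (par (lower e)) (lower e))
      not-linked e = Sum.[ proj₁ (no-link e) , proj₂ (no-link e) ]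
        where
        no-link = λ e → Crest-not-linked (ctr-center _) (away≢root e) (lower-crest e)

    T : Graph (SpidersVertex k)
    T = joinSpiders k newEdges

    added⇒∼ : ∀ {p q e} → NewEdges.ends newEdges e ≡ (p , q) → place p ∼ place q
    added⇒∼ {e = e} refl = subst₂ _∼_ (sym (place-unplace _)) (sym (place-unplace _)) (par-adj (lower≢root e))

    T⇒∼ : ∀ {p q} → Adj T p q → place p ∼ place q
    T⇒∼ (inj₁ adj) = Sum.[ Link⇒∼ , ∼-sym ∘ Link⇒∼ ] (spiders⇒Link adj)
    T⇒∼ (inj₂ (fwd (_ , eq))) = added⇒∼ eq
    T⇒∼ (inj₂ (bwd (_ , eq))) = ∼-sym (added⇒∼ eq)

    ◂⇒T : ∀ {p q} → place p ◂ place q → Adj T p q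
    ◂⇒T {p} {q} p◂q with edgeKind p◂q
    ... | linked l   = inj₁ (Link⇒spiders l)
    ... | linked⁻¹ l = inj₁ (adjSym (spiders k) {q} {p} (Link⇒spiders l))
    ... | crested u cu u≢root c with away-index cu u≢root
    ...   | e , refl = inj₂ (fwd (e , cong₂ _,_
              (place-injective (trans (place-unplace _) lower≡p))
              (place-injective (trans (place-unplace _) (trans (cong par lower≡p) (proj₂ p◂q))))))
      where
      lower≡p : lower e ≡ place p
      lower≡p = Crest-functional (lower-crest e) c

    ∼⇒T : ∀ {p q} → place p ∼ place q → Adj T p q
    ∼⇒T {p} {q} p∼q with adj-par p∼q
    ... | inj₁ p◂q = ◂⇒T p◂q
    ... | inj₂ q◂p = adjSym T {q} {p} (◂⇒T q◂p)

    G≅T : G ≅ T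
    G≅T = ≅-from-bijection place place-injective place-surjective λ p q → mk⇔ T⇒∼ ∼⇒T

    foot-is-leaf : ∀ {i} (j : Fin (k i)) → IsLeaf (spider (k i)) (foot j)
    foot-is-leaf j = [ middle j ] , [] ∷ [] ,
      (λ y → mk⇔ (λ { (here refl) → bwd (middle-foot j) }) (λ { (bwd (middle-foot j)) → here refl })) , refl

    pendant-foot : ∀ {i} (j : Fin (k i)) → Pendant (leg i j) → HasDegree T (i , foot j) 1
    pendant-foot {i} j pendant = [ i , middle j ] , [] ∷ [] ,
      (λ y → mk⇔ (λ { (here refl) → inj₁ (inPart (bwd (middle-foot j))) })
                 (λ adj → here (place-injective (pendant _ (∼-sym (T⇒∼ {i , foot j} adj)))))) , refl

    pendant-legs : ∀ i → ∃[ j ] ∃[ j′ ] (j ≢ j′ × Pendant (leg i j) × Pendant (leg i j′))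
    pendant-legs i with two-pendant-legs (ctr-center i)
    ... | t , t′ , t≢t′ , (top , eq , pendant) , (top′ , eq′ , pendant′)
      with Legs.index i (top , eq) | Legs.index i (top′ , eq′)
    ... | j , refl | j′ , refl = j , j′ , (λ { refl → t≢t′ refl }) , pendant , pendant′

    construction : Construction
    construction = record
      { k      = k
      ; 2≤k    = λ i → ≢⇒2≤ (proj₁ (proj₂ (proj₂ (pendant-legs i))))
      ; E      = newEdges
      ; isTree = ≅-IsTree G≅T isTree
      ; C1     = λ e → Sum.map center⇒IsCenter center⇒IsCenter (Crest-center (ctr-center _) (lower-crest e))
      ; C2     = λ i → let j , j′ , j≢j′ , pendant , pendant′ = pendant-legs i in
          foot j , foot j′ , j≢j′ ∘ foot-injective , foot-is-leaf j , foot-is-leaf j′ ,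
          pendant-foot j pendant , pendant-foot j′ pendant′
      }

  in-𝓕 : G ∈𝓕
  in-𝓕 = assemble centers
    where
    assemble : Enumeration Center → G ∈𝓕
    -- The root is a center, so the enumeration is nonempty, and its size `suc r` determines the
    -- number `r` of added edges.
    assemble record { size = zero ; index = index } = contradiction (proj₁ (index root-center)) λ ()
    assemble record { size = suc r ; at = at ; holds = holds ; injective = injective ; index = index } =
      Assembly.construction at holds injective index , Assembly.G≅T at holds injective index

-- Necessity

module Ownership {G : Graph (Fin n)} {M : EdgeSet G} (ind : IsInducedMatching G M)
                 {root : Fin n} (rooted : Rooted G root) where
  open Edges G
  open RootedClaims {G = G} {M} ind rooted

  module Assignment (root-uncovered : ¬ Covered root)
    (two-spare : ∀ {u} → ¬ Covered u → ∃[ t ] ∃[ t′ ] (t ≢ t′ × Spare u t × Spare u t′)) where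

    Top⇒≢root : ∀ {t} → Top t → t ≢ root
    Top⇒≢root top refl = root-uncovered (proj₁ top)

    NeedyChild : Fin n → Fin n → Set
    NeedyChild t v = v ◂ t × ¬ Covered v × Needy t v

    needyChild? : ∀ t → Decidable (NeedyChild t)
    needyChild? t v with v ◂? t
    ... | no ¬v◂t = no (¬v◂t ∘ proj₁)
    ... | yes v◂t = (v ◂? t) ×-dec ¬? (covered? v) ×-dec subst (λ p → Dec (Needy p v)) (proj₂ v◂t) (needy? v)

    -- Edges of M that are claimed by no child go to the center above them.
    owner : Fin n → Fin n
    owner t = choose (needyChild? t) (par t)

    owner-cases : ∀ t → (owner t ≡ par t × ¬ ∃ (NeedyChild t)) ⊎ NeedyChild t (owner t)
    owner-cases t = choose-cases (needyChild? t) (par t)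

    owner-uncovered : ∀ {t} → Top t → ¬ Covered (owner t)
    owner-uncovered {t} top with owner-cases t
    ... | inj₁ (eq , _) = subst (¬_ ∘ Covered) (sym eq) (par-of-Top top (Top⇒≢root top))
    ... | inj₂ (_ , ¬cov , _) = ¬cov

    owner-adjacent : ∀ {t} → Top t → owner t ∼ t
    owner-adjacent {t} top with owner-cases t
    ... | inj₁ (eq , _) = subst (_∼ t) (sym eq) (∼-sym (par-adj (Top⇒≢root top)))
    ... | inj₂ (v◂t , _) = ◂⇒∼ v◂t

    PendantLeg : Fin n → Fin n → Set
    PendantLeg u t = Top t × owner t ≡ u × Pendant t

    -- A needy uncovered child of `t` would claim `t`; without one, `owner` falls back to the parent
    -- `u`.
    child-spare : ∀ {u t} → ¬ Covered u → t ◂ u → Spare u t → PendantLeg u t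
    child-spare {u} {t} ¬cov t◂u (_ , cov , pendant , ¬claimed) =
      covered-child t◂u cov ¬cov , owned (owner-cases t) , pendant
      where
      owned : (owner t ≡ par t × ¬ ∃ (NeedyChild t)) ⊎ NeedyChild t (owner t) → owner t ≡ u
      owned (inj₁ (eq , _)) = trans eq (proj₂ t◂u)
      owned (inj₂ (v◂t , ¬cov′ , nd)) =
        contradiction (owner t , ◂⇒∼ v◂t , ¬cov′ , (λ eq → ◂-asym t◂u (subst (_◂ t) eq v◂t)) , nd) ¬claimed

    -- `u` is a needy child of `t`, and any other would claim `t`, so the choice in `owner` is
    -- forced. If `t` were a bottom, its mate `par t`, which is not the root, would have
    -- `par (par t)` as a second neighbour, against pendancy.
    parent-spare : ∀ {u t} → ¬ Covered u → u ◂ t → Needy t u → Spare u t → PendantLeg u t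
    parent-spare {u} {t} ¬cov u◂t nd (_ , cov , pendant , ¬claimed) =
      (cov , ¬bottom) , owned (owner-cases t) , pendant
      where
      ¬bottom : ¬ Bottom t
      ¬bottom bot = ◂-asym (Bottom⇒◂ bot) (subst (par t ◂_) grandparent (◂par pt≢root))
        where
        pt≢root : par t ≢ root
        pt≢root = Top⇒≢root (Bottom⇒Top-par bot)

        grandparent : par (par t) ≡ t
        grandparent = pendant _ (subst (par (par t) ∼_) (sym (mate-Bottom bot)) (∼-sym (par-adj pt≢root)))

      owned : (owner t ≡ par t × ¬ ∃ (NeedyChild t)) ⊎ NeedyChild t (owner t) → owner t ≡ u
      owned (inj₁ (_ , none)) = contradiction (u , u◂t , ¬cov , nd) none
      owned (inj₂ (v◂t , ¬cov′ , nd′)) with owner t ≟ᶠ u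
      ... | yes eq = eq
      ... | no v≢u = contradiction (owner t , ◂⇒∼ v◂t , ¬cov′ , v≢u , nd′) ¬claimed

    available⇒leg : ∀ {u t} → ¬ Covered u → Available u t → PendantLeg u t
    available⇒leg ¬cov (t◂u , rest) = child-spare ¬cov t◂u (◂⇒∼ t◂u , rest)

    -- If `u` is needy, it owns the edge above it besides the one below; otherwise there are already
    -- two available edges below.
    mixed : ∀ {u t t′} → ¬ Covered u → t ≢ t′ → t ◂ u → u ◂ t′ → Spare u t → Spare u t′ →
            ∃[ s ] ∃[ s′ ] (s ≢ s′ × PendantLeg u s × PendantLeg u s′)
    mixed {u} {t} {t′} ¬cov t≢t′ t◂u u◂t′ spare spare′ with needy? u
    ... | yes nd = t , t′ , t≢t′ , child-spare ¬cov t◂u spare ,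
                   parent-spare ¬cov u◂t′ (subst (λ p → Needy p u) (proj₂ u◂t′) nd) spare′
    ... | no ¬nd with two-available ¬nd (t , t◂u , proj₁ (proj₂ spare))
    ...   | s , s′ , s≢s′ , avail , avail′ = s , s′ , s≢s′ , available⇒leg ¬cov avail , available⇒leg ¬cov avail′

    two-pendant-legs : ∀ {u} → ¬ Covered u → ∃[ t ] ∃[ t′ ] (t ≢ t′ × PendantLeg u t × PendantLeg u t′)
    two-pendant-legs ¬cov with two-spare ¬cov
    ... | t , t′ , t≢t′ , spare , spare′ with adj-par (proj₁ spare) | adj-par (proj₁ spare′)
    ... | inj₁ t◂u | inj₁ t′◂u = t , t′ , t≢t′ , child-spare ¬cov t◂u spare , child-spare ¬cov t′◂u spare′
    ... | inj₁ t◂u | inj₂ u◂t′ = mixed ¬cov t≢t′ t◂u u◂t′ spare spare′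
    ... | inj₂ u◂t | inj₁ t′◂u = mixed ¬cov (t≢t′ ∘ sym) t′◂u u◂t spare′ spare
    ... | inj₂ u◂t | inj₂ u◂t′ = contradiction (◂-functional u◂t u◂t′) t≢t′


    spiderCover : SpiderCover rooted
    spiderCover = record
      { Center           = λ x → ¬ Covered x
      ; Top              = Top
      ; Bottom           = Bottom
      ; center?          = λ x → ¬? (covered? x)
      ; top?             = top?
      ; kind             = λ x → case kind x of λ where
                             (is-uncovered ¬cov) → inj₁ ¬cov
                             (is-top top)        → inj₂ (inj₁ top)
                             (is-bottom bot)     → inj₂ (inj₂ bot)
      ; center≢top       = λ ¬cov top → ¬cov (proj₁ top)
      ; center≢bottom    = λ ¬cov bot → ¬cov (Bottom⇒Covered bot)
      ; top≢bottom       = proj₂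
      ; root-center      = root-uncovered
      ; mate             = mate
      ; owner            = owner
      ; mate-bottom      = Top⇒mate-Bottom
      ; par-mate         = par-mate
      ; mate-par         = mate-par-Bottom
      ; par-top          = Bottom⇒Top-par
      ; par-center       = λ top → par-of-Top top (Top⇒≢root top)
      ; owner-center     = owner-uncovered
      ; owner-adjacent   = owner-adjacent
      ; two-pendant-legs = two-pendant-legs
      }

-- One or two vertices, and the classification

module _ {G : Graph (Fin n)} (isTree : IsTree G) where
  open Edges G
  open IsTree isTree

  one-vertex : ∀ {x} → (∀ {y} → ¬ x ∼ y) → G ≅ path 1
  one-vertex {x} isolated = ≅-from-bijection (λ _ → x) (λ { {zero} {zero} _ → refl })
    (λ y → zero , only (connected x y))
    (λ { zero zero → mk⇔ (λ { (fwd ()) ; (bwd ()) }) (λ x∼x → contradiction x∼x isolated) })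
    where
    only : ∀ {y} → Star _∼_ x y → x ≡ y
    only ε = refl
    only (x∼z ◅ _) = contradiction x∼z isolated

  two-vertices : ∀ {x y} → x ∼ y → (∀ {z} → x ∼ z → z ≡ y) → (∀ {z} → y ∼ z → z ≡ x) → G ≅ path 2
  two-vertices {x} {y} x∼y only-y only-x =
    ≅-from-bijection f f-injective (λ z → either (reached (inj₁ refl) (connected x z))) f-adj
    where
    f : Fin 2 → Fin n
    f zero       = x
    f (suc zero) = y

    f-injective : ∀ {i j} → f i ≡ f j → i ≡ j
    f-injective {zero}     {zero}     _  = refl
    f-injective {zero}     {suc zero} eq = contradiction eq (∼⇒≢ x∼y)
    f-injective {suc zero} {zero}     eq = contradiction (sym eq) (∼⇒≢ x∼y)
    f-injective {suc zero} {suc zero} _  = refl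

    reached : ∀ {v w} → v ≡ x ⊎ v ≡ y → Star _∼_ v w → w ≡ x ⊎ w ≡ y
    reached v∈ ε = v∈
    reached (inj₁ refl) (x∼z ◅ s) = reached (inj₂ (only-y x∼z)) s
    reached (inj₂ refl) (y∼z ◅ s) = reached (inj₁ (only-x y∼z)) s

    either : ∀ {z} → z ≡ x ⊎ z ≡ y → ∃[ i ] f i ≡ z
    either (inj₁ z≡x) = zero , sym z≡x
    either (inj₂ z≡y) = suc zero , sym z≡y

    f-adj : ∀ i j → Adj (path 2) i j ⇔ f i ∼ f j
    f-adj zero       zero       = mk⇔ (λ { (fwd ()) ; (bwd ()) }) (λ x∼x → contradiction x∼x (irrefl G x))
    f-adj zero       (suc zero) = mk⇔ (λ _ → x∼y) (λ _ → fwd refl)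
    f-adj (suc zero) zero       = mk⇔ (λ _ → ∼-sym x∼y) (λ _ → bwd refl)
    f-adj (suc zero) (suc zero) = mk⇔ (λ { (fwd ()) ; (bwd ()) }) (λ y∼y → contradiction y∼y (irrefl G y))

  module MaximumMatching {M : EdgeSet G} (ind : IsInducedMatching G M)
                         (maximum : ∀ B → IsEOP G B → ∣ B ∣ ≤ ∣ M ∣) where
    open InducedMatching {G = G} {M} ind
    open Claims {G = G} {M} ind using (Spare)

    child-of-root : ∀ u {z} → z ∼ u → RootedTree._◂_ (rootAt G isTree u) z u
    child-of-root u z∼u = RootedTree.∼⇒child (rootAt G isTree u) (∼-sym z∼u)
      λ eq → ∼⇒≢ z∼u (trans eq (Rooted.par-root (rootAt G isTree u)))

    covered-neighbour : ∀ {u z} → ¬ Covered u → u ∼ z → ∃[ c ] (c ∼ u × Covered c)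
    covered-neighbour {u} {z} ¬cov u∼z with any? (λ c → adj? G c u ×-dec covered? c)
    ... | yes found = found
    ... | no none = ⊥-elim (RootedClaims.MaximumAt.Isolated.absurd {M = M} ind (rootAt G isTree u) maximum ¬cov
            (λ v∼u cov → none (_ , v∼u , cov)) (child-of-root u (∼-sym u∼z)))

    -- The tree is rooted at `u` itself, where `root-not-needy` applies and all neighbours are
    -- children. Connectedness to `x` provides a neighbour of `u`, hence a covered one.
    two-spare : ∀ {x} → Covered x → ∀ {u} → ¬ Covered u → ∃[ t ] ∃[ t′ ] (t ≢ t′ × Spare u t × Spare u t′)
    two-spare {x} cov-x {u} ¬cov with connected u x
    ... | ε = contradiction cov-x ¬cov
    ... | u∼z ◅ _ =
      let c , c∼u , cov = covered-neighbour ¬cov u∼z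
          t , t′ , t≢t′ , (t◂u , rest) , (t′◂u , rest′) =
            two-available (MaximumAt.root-not-needy maximum ¬cov) (c , child-of-root u c∼u , cov)
      in t , t′ , t≢t′ , (◂⇒∼ t◂u , rest) , (◂⇒∼ t′◂u , rest′)
      where
      open RootedClaims {M = M} ind (rootAt G isTree u) using (two-available; ◂⇒∼; module MaximumAt)

    -- If no vertex is covered, there is no edge, since an edge would yield a covered neighbour. If
    -- all are covered, every edge lies in `M`, so each vertex has one neighbour.
    classification : G ∈𝓕 ⊎ G ≅ path 1 ⊎ G ≅ path 2
    classification with any? covered? | any? (λ x → ¬? (covered? x))
    ... | yes (x , cov) | yes (root , ¬cov) =
      inj₁ (SpiderCover⇒𝓕.in-𝓕 isTree
        (Ownership.Assignment.spiderCover {M = M} ind (rootAt G isTree root) ¬cov (two-spare cov)))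
    ... | no none | _ = inj₂ (inj₁ (one-vertex {nonempty} λ x∼y →
      let c , _ , cov = covered-neighbour (λ cov → none (_ , cov)) x∼y in none (c , cov)))
    ... | yes (x , y , x-y) | no all-covered = inj₂ (inj₂ (two-vertices (Mt⇒∼ x-y)
      (λ x∼z → Mt-functional (mt x∼z) x-y) (λ y∼z → Mt-functional (mt y∼z) (Mt-sym x-y))))
      where
      covered : ∀ z → Covered z
      covered z with covered? z
      ... | yes cov = cov
      ... | no ¬cov = contradiction (z , ¬cov) all-covered

      mt : ∀ {v w} → v ∼ w → Mt v w
      mt v∼w = covered-adjacent (covered _) (covered _) v∼w

corollary2p9 : (n : ℕ) (T : Graph (Fin n)) → IsTree T → (ρₑᵒ T ≡ νᴵ T) ⇔ (T ∈𝓕 ⊎ T ≅ path 1 ⊎ T ≅ path 2)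
corollary2p9 n T isTree = mk⇔ only-if Sum.[ (λ (C , T≅) → 𝓕⇒ρₑᵒ≡νᴵ T C T≅) , path-≅⇒ρₑᵒ≡νᴵ T ]
  where
  only-if : ρₑᵒ T ≡ νᴵ T → T ∈𝓕 ⊎ T ≅ path 1 ⊎ T ≅ path 2
  only-if ρ≡ν with maxCard-attained (isInducedMatching? T) (Edges.∅-isInducedMatching T)
  ... | M , ind , ∣M∣≡ν = MaximumMatching.classification isTree {M} ind λ B eop →
    subst (∣ B ∣ ≤_) (trans ρ≡ν (sym ∣M∣≡ν)) (≤-maxCard (isEOP? T) B eop)
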